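{- Let $n\ge 1$, let $a_{i,j}$ ($1\le i\le j\le n$) and $b_{i,j}$ ($1\le i<j\le n$) be complex indeterminates, and let $M_F$ and $M_B$ be the $n\times n$ matrices $$(M_{F})_{i,j} = \begin{cases} a_{i,j} + b_{i,j} & i < j, \\ a_{j,i} - b_{j,i} & i > j, \\ a_{i,i} & i=j, \end{cases}\qquad (M_{B})_{i,j} = \begin{cases} a_{i,j} + \sqrt{ -1}\, b_{i,j} & i < j, \\ a_{j,i} - \sqrt{ -1}\, b_{j,i} & i > j, \\ a_{i,i} & i=j. \end{cases}$$ Then $$\det(M_F) = \sum_{\mu \in (\mathcal{B}_{F})_n} (-1)^{\chi(\mu)} w(\mu),\qquad \det(M_B) = (-1)^{\binom{n}{2}}\sum_{\mu \in (\mathcal{B}_{B})_n} (-1)^{\chi(\mu)}w(\mu),$$ where $(\mathcal{B}_F)_n$ and $(\mathcal{B}_B)_n$ are the sets of $F$-Brauer and $B$-Brauer diagrams of size $n$, $\chi$ is the crossing number and $w$ is the weight.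
   Context: Place $2n$ vertices in two horizontal rows, a top row $T$ and a bottom row $B$, each with $n$ vertices. An (unlabeled) Brauer diagram $\mu$ of size $n$ is a perfect matching of these $2n$ vertices, drawn in the strip between the two rows. An edge joining two vertices of $T$ is a cup, an edge joining two vertices of $B$ is a cap, and an edge joining a vertex of $T$ to a vertex of $B$ is an arc. The drawing is such that two caps, or two cups, meet in at most one point; a cap and a cup do not meet; an arc meets any other arc, cap or cup in at most one point. The crossing number $\chi(\mu)$ is the number of pairwise intersections among edges of $\mu$. Equivalently, in terms of positions from left to right in each row: two cups (or two caps) cross if and only if their endpoints interleave; a cup (resp. cap) and an arc cross if and only if the top (resp. bottom) endpoint of the arc lies strictly between the two endpoints of the cup (resp. cap); two arcs cross if and only if the left-to-right order of their top endpoints is opposite to that of their bottom endpoints; a cup and a cap never cross. Labelings: the vertices of $T$ are always labeled $1,\dots,n$ from left to right. In an $F$-Brauer diagram the vertices of $B$ are labeled $1,\dots,n$ from left to right; in a $B$-Brauer diagram they are labeled $1,\dots,n$ from right to left. $(\mathcal{B}_F)_n$ and $(\mathcal{B}_B)_n$ denote the sets of all $F$-Brauer, respectively $B$-Brauer, diagrams of size $n$. For a labeled diagram $\mu$, let $\mu_T$, $\mu_B$, $\mu_{TB}$ be its sets of cups, caps and arcs, written as ordered pairs of labels: cups and caps are written $(i,j)$ with $i<j$; arcs are written with the top label first. Put $(\widehat{i,j})=(\min(i,j),\max(i,j))$. The weight of $\mu$ is $$w(\mu) = \prod_{(i,j) \in \mu_T} b_{i,j} \prod_{(i,j) \in \mu_B}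 b_{i,j} \prod_{(i,j) \in \mu_{TB}} a_{\widehat{i,j}}.$$ -}

module Defs where

open import Algebra.Bundles using (CommutativeRing)
import Algebra.Properties.Semiring.Exp as Exp
open import Data.Bool.Base using (if_then_else_)
open import Data.Fin.Base using (Fin; zero; suc; opposite; _<_)
open import Data.Fin.Permutation using (Permutation′; _⟨$⟩ʳ_; id; insert)
open import Data.Fin.Properties using (_<?_; _≤?_; <-cmp; all?)
import Data.Fin.Properties as Fin
open import Data.List.Base
  using (List; []; _∷_; _++_; map; filter; foldr; length; allFin;
         cartesianProduct; cartesianProductWith)
open import Data.Nat.Base as ℕ using (ℕ; zero; suc)
import Data.Nat.Properties as ℕ
open import Data.Product.Base using (_×_; _,_; uncurry)
open import Data.Sum.Base using (_⊎_; inj₁; inj₂)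
import Data.Sum.Properties as Sum
open import Data.Empty using (⊥)
open import Relation.Binary.Definitions using (tri<; tri≈; tri>)
open import Relation.Binary.PropositionalEquality.Core using (_≡_)
open import Relation.Nullary.Decidable.Core using (Dec; does; no; _×-dec_; _⊎-dec_)
open import Relation.Unary using (Decidable)

private
  variable
    n : ℕ
    A : Set

pairs : ∀ n → List (Fin n × Fin n)
pairs n = cartesianProduct (allFin n) (allFin n)

increasingPairs : ∀ n → List (Fin n × Fin n)
increasingPairs n = filter (λ (i , j) → i <? j) (pairs n)

sublists : List A → List (List A)
sublists []       = [] ∷ []
sublists (x ∷ xs) = sublists xs ++ map (x ∷_) (sublists xs)

-- Every permutation of Fin (suc n) is, up to pointwise equality,
-- insert zero j π for exactly one j and one π; see insert-remove and
-- remove-insert in Data.Fin.Permutation.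
permutations : ∀ n → List (Permutation′ n)
permutations zero    = id ∷ []
permutations (suc n) =
  cartesianProductWith (insert zero) (allFin (suc n)) (permutations n)

inversions : Permutation′ n → ℕ
inversions {n} π =
  length (filter (λ (i , j) → (π ⟨$⟩ʳ j) <? (π ⟨$⟩ʳ i)) (increasingPairs n))

-- Vertices are given by their row and their position from left to right,
-- whatever the labelling.
Vertex : ℕ → Set
Vertex n = Fin n ⊎ Fin n

pattern top i    = inj₁ i
pattern bottom i = inj₂ i

data Edge (n : ℕ) : Set where
  cup : (i j : Fin n) → Edge n
  cap : (i j : Fin n) → Edge n
  arc : (t b : Fin n) → Edge n

-- The two-element sets of vertices, each listed once.
edges : ∀ n → List (Edge n)
edges n = map (uncurry cup) (increasingPairs n)
       ++ map (uncurry cap) (increasingPairs n)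
       ++ map (uncurry arc) (pairs n)

endpoints : Edge n → Vertex n × Vertex n
endpoints (cup i j) = top i , top j
endpoints (cap i j) = bottom i , bottom j
endpoints (arc t b) = top t , bottom b

_∈ₑ_ : Vertex n → Edge n → Set
v ∈ₑ e = let (u , w) = endpoints e in v ≡ u ⊎ v ≡ w

_∈ₑ?_ : (v : Vertex n) → Decidable (v ∈ₑ_)
v ∈ₑ? e = let (u , w) = endpoints e in (v ≟ u) ⊎-dec (v ≟ w)
  where _≟_ = Sum.≡-dec Fin._≟_ Fin._≟_

degree : Vertex n → List (Edge n) → ℕ
degree v es = length (filter (v ∈ₑ?_) es)

IsPerfectMatching : List (Edge n) → Set
IsPerfectMatching es =
  (∀ i → degree (top i) es ≡ 1) × (∀ i → degree (bottom i) es ≡ 1)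

isPerfectMatching? : Decidable (IsPerfectMatching {n})
isPerfectMatching? es =
  all? (λ i → degree (top i) es ℕ.≟ 1) ×-dec
  all? (λ i → degree (bottom i) es ℕ.≟ 1)

-- A sublist of edges n is a set of edges, so this lists each perfect
-- matching once.
brauerDiagrams : ∀ n → List (List (Edge n))
brauerDiagrams n = filter isPerfectMatching? (sublists (edges n))

Interleave : (i j k l : Fin n) → Set
Interleave i j k l = (i < k × k < j × j < l) ⊎ (k < i × i < l × l < j)

Between : (i t j : Fin n) → Set
Between i t j = i < t × t < j

Crosses : Edge n → Edge n → Set
Crosses (cup i j) (cup k l) = Interleave i j k l
Crosses (cup i j) (cap k l) = ⊥
Crosses (cup i j) (arc t b) = Between i t j
Crosses (cap i j) (cup k l) = ⊥
Crosses (cap i j) (cap k l) = Interleave i j k l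
Crosses (cap i j) (arc t b) = Between i b j
Crosses (arc t b) (cup i j) = Between i t j
Crosses (arc t b) (cap i j) = Between i b j
Crosses (arc t b) (arc u c) = (t < u × c < b) ⊎ (u < t × b < c)

interleave? : (i j k l : Fin n) → Dec (Interleave i j k l)
interleave? i j k l =
  (i <? k ×-dec k <? j ×-dec j <? l) ⊎-dec (k <? i ×-dec i <? l ×-dec l <? j)

between? : (i t j : Fin n) → Dec (Between i t j)
between? i t j = i <? t ×-dec t <? j

crosses? : (e : Edge n) → Decidable (Crosses e)
crosses? (cup i j) (cup k l) = interleave? i j k l
crosses? (cup i j) (cap k l) = no λ ()
crosses? (cup i j) (arc t b) = between? i t j
crosses? (cap i j) (cup k l) = no λ ()
crosses? (cap i j) (cap k l) = interleave? i j k l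
crosses? (cap i j) (arc t b) = between? i b j
crosses? (arc t b) (cup i j) = between? i t j
crosses? (arc t b) (cap i j) = between? i b j
crosses? (arc t b) (arc u c) = (t <? u ×-dec c <? b) ⊎-dec (u <? t ×-dec b <? c)

-- Crosses is symmetric, so each unordered pair of edges is counted once.
χ : List (Edge n) → ℕ
χ []       = 0
χ (e ∷ es) = length (filter (crosses? e) es) ℕ.+ χ es

data Labelling : Set where
  F B : Labelling

-- The label of the bottom vertex at a given position; a top vertex is
-- always labelled by its position.
bottomLabel : Labelling → Fin n → Fin n
bottomLabel F i = i
bottomLabel B i = opposite i

-- The entry of x at (min(i,j), max(i,j)).
sorted : ∀ {c} {C : Set c} → (Fin n → Fin n → C) → Fin n → Fin n → C
sorted x i j = if does (i ≤? j) then x i j else x j i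

module _ {c ℓ} (R : CommutativeRing c ℓ) where

  open CommutativeRing R
  open Exp semiring using (_^_)

  Matrix : ℕ → Set c
  Matrix n = Fin n → Fin n → Carrier

  ∑ : ∀ {a} {I : Set a} → List I → (I → Carrier) → Carrier
  ∑ is f = foldr _+_ 0# (map f is)

  ∏ : ∀ {a} {I : Set a} → List I → (I → Carrier) → Carrier
  ∏ is f = foldr _*_ 1# (map f is)

  sign : ℕ → Carrier
  sign k = (- 1#) ^ k

  det : Matrix n → Carrier
  det {n} M = ∑ (permutations n) λ π →
    sign (inversions π) * ∏ (allFin n) λ i → M i (π ⟨$⟩ʳ i)

  -- Only the entries a i j with i ≤ j and b i j with i < j are used by
  -- the definitions below.
  module _ (a b : Matrix n) where

    M-F : Matrix n
    M-F i j with <-cmp i j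
    ... | tri< _ _ _ = a i j + b i j
    ... | tri≈ _ _ _ = a i i
    ... | tri> _ _ _ = a j i - b j i

    M-B : (ι : Carrier) → Matrix n
    M-B ι i j with <-cmp i j
    ... | tri< _ _ _ = a i j + ι * b i j
    ... | tri≈ _ _ _ = a i i
    ... | tri> _ _ _ = a j i - ι * b j i

    -- With right-to-left labels the order of the two ends of a cap is
    -- reversed, hence sorted also for caps.
    edgeWeight : Labelling → Edge n → Carrier
    edgeWeight L (cup i j) = b i j
    edgeWeight L (cap i j) = sorted b (bottomLabel L i) (bottomLabel L j)
    edgeWeight L (arc i j) = sorted a i (bottomLabel L j)

    weight : Labelling → List (Edge n) → Carrier
    weight L μ = ∏ μ (edgeWeight L)

{-# OPTIONS --safe #-}
module Submission where

-- Read along the boundary of the strip (top row from left to right, then bottom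
-- row from right to left), a Brauer diagram is a perfect matching of 2n points
-- on a circle and χ counts its crossing chords, so the signed sum over Brauer
-- diagrams is the Pfaffian of a skew form on the vectors t₁, …, tₙ, b₁, …, bₙ
-- attached to the vertices. With S the skew matrix of the b i j and A the
-- symmetric matrix of the a i j, the form is ω(tᵢ,tⱼ) = Sᵢⱼ, ω(tᵢ,bⱼ) = Aᵢⱼ and
-- ω(bᵢ,bⱼ) = κ Sᵢⱼ, where bᵢ belongs to the bottom vertex labelled i, and κ = -1
-- for F, κ = 1 for B. If k²κ = -1, the vectors tᵢ + k bᵢ are mutually isotropic.
-- Replacing tᵢ by tᵢ + k bᵢ does not change the Pfaffian, which becomes, up to a
-- sign, the determinant of ω(tᵢ + k bᵢ, bⱼ) = Aᵢⱼ + k κ Sᵢⱼ; take k = -1 for F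
-- and k = ι for B.

open import Defs
open import Algebra.Bundles using (CommutativeRing; CommutativeMonoid)
open import Data.Bool.Base using (if_then_else_)
open import Data.Fin.Base as Fin
  using (Fin; zero; suc; toℕ; punchIn; opposite; inject₁; fromℕ; _<_)
open import Data.Fin.Permutation
  using (Permutation′; _⟨$⟩ʳ_; _⟨$⟩ˡ_; insert; inverseʳ; inverseˡ)
open import Data.Fin.Properties as Fin using (_<?_; punchIn-mono-≤; punchIn-cancel-≤)
open import Data.List.Base
  using (List; []; _∷_; _++_; _∷ʳ_; length; reverse; map; filter; allFin; tabulate;
         cartesianProduct; cartesianProductWith)
import Data.List.Properties as List
open import Data.List.Membership.Propositional using (_∈_)
open import Data.List.Membership.Propositional.Properties
  using (∈-++⁺ˡ; ∈-++⁺ʳ; ∈-++⁻; ∈-map⁺; ∈-map⁻; ∈-filter⁺; ∈-filter⁻; ∈-allFin; ∈-cartesianProduct⁺)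
open import Data.List.Membership.Propositional.Properties.WithK using (unique∧set⇒bag)
open import Data.List.Relation.Binary.BagAndSetEquality using (∼bag⇒↭)
open import Data.List.Relation.Binary.Permutation.Propositional as ↭ using (_↭_; ↭-refl)
open import Data.List.Relation.Binary.Permutation.Propositional.Properties using (filter-↭; ↭-length)
open import Data.List.Relation.Unary.All as All using (All; []; _∷_)
import Data.List.Relation.Unary.All.Properties as All
open import Data.List.Relation.Unary.AllPairs as AllPairs using (AllPairs; []; _∷_)
import Data.List.Relation.Unary.AllPairs.Properties as AllPairs
open import Data.List.Relation.Unary.Any using (Any; here; there)
open import Data.List.Relation.Unary.Unique.Propositional using (Unique)
import Data.List.Relation.Unary.Unique.Propositional.Properties as Unique
open import Data.Nat.Base as ℕ using (ℕ; zero; suc; s≤s; _≥_)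
import Data.Nat.Properties as ℕ
import Algebra.Properties.CommutativeSemigroup ℕ.+-commutativeSemigroup as ℕ+
open import Data.Nat.Combinatorics using (_C_; nCk+nC[k+1]≡[n+1]C[k+1]; nC1≡n)
open import Data.Product.Base as Product using (_×_; _,_; uncurry; proj₁; proj₂; Σ)
open import Data.Sum.Base as Sum using (_⊎_; inj₁; inj₂)
import Data.Sum.Properties as Sum
open import Data.Sum.Relation.Binary.LeftOrder
  using (_⊎-<_; ₁∼₁; ₁∼₂; ₂∼₂; ⊎-<-asymmetric; ⊎-<-transitive)
open import Data.Unit.Base using (⊤)
open import Function.Base using (_∘_; id; flip)
open import Function.Bundles using (mk⇔)
open import Relation.Binary.Definitions using (tri<; tri≈; tri>)
open import Relation.Binary.PropositionalEquality as ≡ using (_≡_; _≢_)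
open import Relation.Nullary.Decidable
  using (Dec; yes; no; does; does-⇔; ¬?; dec-true; dec-false)
open import Relation.Nullary.Negation using (¬_; contradiction)
open import Relation.Unary using (Decidable)

-- The boundary runs through the bottom row from right to left, and this fixes κ and the sign. A cap
-- is read from its right end to its left end. With left-to-right labels that is from the larger
-- label to the smaller, where S has the entry -b, and κ = -1 restores the weight b; with
-- right-to-left labels the labels increase and κ = 1. Likewise the bottom vectors appear as bₙ,
-- ..., b₁ for F and as b₁, ..., bₙ for B. Pairing n isotropic vectors with n further ones gives a
-- determinant up to (-1)^(n choose 2); reversing the further ones costs the same sign again, so it
-- survives for B and cancels for F.
--
-- In an arbitrary commutative ring 2 need not be cancellable, so skewness does not give ω(x,x) = 0,
-- nor does the sign change under transposition make a Pfaffian with a repeated vector vanish. Both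
-- are established separately.
--
-- Crossings enter through the first vertex v: if v is matched with w, another edge crosses vw
-- exactly when precisely one of its ends lies between v and w. The number of crossings on vw thus
-- has the parity of the number of vertices between them, which is the sign of w in the expansion
-- along v.

private
  variable
    n : ℕ
    A I J : Set
    P Q : A → Set
    xs ys : List A

-- Pfaffians

module Pfaffian {c ℓ} (R : CommutativeRing c ℓ) where

  open CommutativeRing R hiding (zero)
  open import Algebra.Properties.Ring ring using (-1*x≈-x; -‿distribˡ-*; -‿distribʳ-*)
  open import Algebra.Properties.AbelianGroup +-abelianGroup
    using () renaming (⁻¹-∙-comm to -‿+-comm; ε⁻¹≈ε to -0≈0; ⁻¹-involutive to -‿involutive; ⁻¹-anti-homo‿- to -[x-y]≈y-x)
  open import Algebra.Solver.Ring.NaturalCoefficients.Default commutativeSemiring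
    using (solve; _:=_; _:+_; _:*_)
  open import Relation.Binary.Reasoning.Setoid setoid

  -[x-y]≈-x+y : ∀ x y → - (x - y) ≈ - x + y
  -[x-y]≈-x+y x y = trans (sym (-‿+-comm x (- y))) (+-congˡ (-‿involutive y))

  -- Alternating sum over the entries of a list, each passed to `g` together with the list that
  -- remains after deleting it. Expansions of Pfaffians and of determinants are both instances, so
  -- one set of rules serves both.
  expand : (A → List A → Carrier) → List A → Carrier
  expand g []       = 0#
  expand g (x ∷ xs) = g x xs - expand (λ y ys → g y (x ∷ ys)) xs

  expand-cong : {g h : A → List A → Carrier} →
    (∀ as x bs → xs ≡ as ++ x ∷ bs → g x (as ++ bs) ≈ h x (as ++ bs)) →
    expand g xs ≈ expand h xs
  expand-cong {xs = []}     eq = refl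
  expand-cong {xs = x ∷ xs} eq = +-cong (eq [] x xs ≡.refl)
    (-‿cong (expand-cong λ as y bs p → eq (x ∷ as) y bs (≡.cong (x ∷_) p)))

  expand-cong′ : {g h : A → List A → Carrier} → (∀ x ys → g x ys ≈ h x ys) →
    ∀ xs → expand g xs ≈ expand h xs
  expand-cong′ eq xs = expand-cong {xs = xs} λ as x bs _ → eq x (as ++ bs)

  expand-linear : ∀ k (g h : A → List A → Carrier) xs →
    expand (λ x ys → g x ys + k * h x ys) xs ≈ expand g xs + k * expand h xs
  expand-linear k g h []       = sym (trans (+-identityˡ _) (zeroʳ k))
  expand-linear k g h (x ∷ xs) = begin
    g x xs + k * h x xs - expand (λ y ys → g y (x ∷ ys) + k * h y (x ∷ ys)) xs
      ≈⟨ +-congˡ (-‿cong (expand-linear k _ _ xs)) ⟩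
    g x xs + k * h x xs - (G + k * H)
      ≈⟨ +-congˡ (-‿+-comm G (k * H)) ⟨
    g x xs + k * h x xs + (- G + - (k * H))
      ≈⟨ +-congˡ (+-congˡ (-‿distribʳ-* k H)) ⟩
    g x xs + k * h x xs + (- G + k * - H)
      ≈⟨ solve 5 (λ k a b c d → a :+ k :* b :+ (c :+ k :* d) := a :+ c :+ k :* (b :+ d)) refl k _ _ _ _ ⟩
    g x xs - G + k * (h x xs - H) ∎
    where
    G = expand (λ y ys → g y (x ∷ ys)) xs
    H = expand (λ y ys → h y (x ∷ ys)) xs

  expand-0 : ∀ (xs : List A) → expand (λ _ _ → 0#) xs ≈ 0#
  expand-0 []       = refl
  expand-0 (x ∷ xs) = trans (+-identityˡ _) (trans (-‿cong (expand-0 xs)) -0≈0)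

  expand-* : ∀ k (g : A → List A → Carrier) xs →
    expand (λ x ys → k * g x ys) xs ≈ k * expand g xs
  expand-* k g xs = begin
    expand (λ x ys → k * g x ys) xs               ≈⟨ expand-cong′ (λ _ _ → +-identityˡ _) xs ⟨
    expand (λ x ys → 0# + k * g x ys) xs          ≈⟨ expand-linear k (λ _ _ → 0#) g xs ⟩
    expand (λ _ _ → 0#) xs + k * expand g xs      ≈⟨ +-congʳ (expand-0 xs) ⟩
    0# + k * expand g xs                          ≈⟨ +-identityˡ _ ⟩
    k * expand g xs                               ∎

  expand-linear′ : ∀ k {f g h : A → List A → Carrier} →
    (∀ x ys → f x ys ≈ g x ys + k * h x ys) →
    ∀ xs → expand f xs ≈ expand g xs + k * expand h xs
  expand-linear′ k eq xs = trans (expand-cong′ eq xs) (expand-linear k _ _ xs)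

  expand-≈0 : {g : A → List A → Carrier} → (∀ x ys → g x ys ≈ 0#) →
    ∀ xs → expand g xs ≈ 0#
  expand-≈0 eq xs = trans (expand-cong′ eq xs) (expand-0 xs)

  expand-neg : {g h : A → List A → Carrier} → (∀ x ys → g x ys ≈ - h x ys) →
    ∀ xs → expand g xs ≈ - expand h xs
  expand-neg {g = g} {h} eq xs = begin
    expand g xs                          ≈⟨ expand-cong′ (λ x ys → trans (eq x ys) (sym (-1*x≈-x _))) xs ⟩
    expand (λ x ys → - 1# * h x ys) xs   ≈⟨ expand-* (- 1#) h xs ⟩
    - 1# * expand h xs                   ≈⟨ -1*x≈-x _ ⟩
    - expand h xs                        ∎

  sgn : List A → Carrier
  sgn xs = sign R (length xs)

  expand-++ : ∀ (g : A → List A → Carrier) xs ys → expand g (xs ++ ys) ≈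
    expand (λ x xs′ → g x (xs′ ++ ys)) xs + sgn xs * expand (λ y ys′ → g y (xs ++ ys′)) ys
  expand-++ g []       ys = sym (trans (+-identityˡ _) (*-identityˡ _))
  expand-++ g (x ∷ xs) ys = begin
    g x (xs ++ ys) - expand (λ y ys′ → g y (x ∷ ys′)) (xs ++ ys)
      ≈⟨ +-congˡ (-‿cong (expand-++ _ xs ys)) ⟩
    g x (xs ++ ys) - (X + sgn xs * Y)
      ≈⟨ +-congˡ (-‿+-comm X _) ⟨
    g x (xs ++ ys) + (- X - sgn xs * Y)
      ≈⟨ +-congˡ (+-congˡ (-1*x≈-x _)) ⟨
    g x (xs ++ ys) + (- X + - 1# * (sgn xs * Y))
      ≈⟨ solve 5 (λ a b m s y → a :+ (b :+ m :* (s :* y)) := a :+ b :+ m :* s :* y) refl _ _ _ _ _ ⟩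
    g x (xs ++ ys) - X + sgn (x ∷ xs) * Y ∎
    where
    X = expand (λ y ys′ → g y (x ∷ (ys′ ++ ys))) xs
    Y = expand (λ y ys′ → g y (x ∷ xs ++ ys′)) ys

  sign*sign≈1 : ∀ k → sign R k * sign R k ≈ 1#
  sign*sign≈1 zero    = *-identityˡ 1#
  sign*sign≈1 (suc k) = begin
    - 1# * sign R k * (- 1# * sign R k)
      ≈⟨ solve 2 (λ m s → m :* s :* (m :* s) := m :* m :* (s :* s)) refl _ _ ⟩
    - 1# * - 1# * (sign R k * sign R k)  ≈⟨ *-cong (trans (-1*x≈-x _) (-‿involutive 1#)) (sign*sign≈1 k) ⟩
    1# * 1#                              ≈⟨ *-identityˡ 1# ⟩
    1#                                   ∎

  -- In a list of length m, reversal moves position p to m - 1 - p, which changes every sign by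
  -- (-1)^(m-1); `sgn xs` is (-1)^m, hence the minus.
  expand-reverse : ∀ (g : A → List A → Carrier) xs →
    sgn xs * expand g (reverse xs) ≈ - expand (λ y ys → g y (reverse ys)) xs
  expand-reverse g []       = trans (zeroʳ _) (sym -0≈0)
  expand-reverse g (x ∷ xs) = begin
    s * expand g (reverse (x ∷ xs))
      ≡⟨ ≡.cong (λ zs → s * expand g zs) (List.unfold-reverse x xs) ⟩
    s * expand g (reverse xs ∷ʳ x)
      ≈⟨ *-congˡ (expand-++ g (reverse xs) (x ∷ [])) ⟩
    s * (E + sgn (reverse xs) * (g x (reverse xs ++ []) - 0#))
      ≡⟨ ≡.cong₂ (λ k zs → s * (E + sign R k * (g x zs - 0#))) (List.length-reverse xs) (List.++-identityʳ (reverse xs)) ⟩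
    - 1# * sgn xs * (E + sgn xs * (G + - 0#))
      ≈⟨ *-congˡ (+-congˡ (*-congˡ (trans (+-congˡ -0≈0) (+-identityʳ G)))) ⟩
    - 1# * sgn xs * (E + sgn xs * G)
      ≈⟨ solve 4 (λ m s e g → m :* s :* (e :+ s :* g) := m :* (s :* s :* g :+ s :* e)) refl _ _ _ _ ⟩
    - 1# * (sgn xs * sgn xs * G + sgn xs * E)
      ≈⟨ *-congˡ (+-cong (trans (*-congʳ (sign*sign≈1 (length xs))) (*-identityˡ G)) ih) ⟩
    - 1# * (G - expand (λ y ys → g y (reverse (x ∷ ys))) xs)
      ≈⟨ -1*x≈-x _ ⟩
    - expand (λ y ys → g y (reverse ys)) (x ∷ xs) ∎
    where
    s = sgn (x ∷ xs)
    E = expand (λ y ys → g y (ys ∷ʳ x)) (reverse xs)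
    G = g x (reverse xs)
    ih : sgn xs * E ≈ - expand (λ y ys → g y (reverse (x ∷ ys))) xs
    ih = trans (expand-reverse (λ y ys → g y (ys ∷ʳ x)) xs)
      (-‿cong (expand-cong′ (λ y ys → reflexive (≡.cong (g y) (≡.sym (List.unfold-reverse x ys)))) xs))

  module _ (ω : A → A → Carrier) where

    -- Expansion along the first vector; m is the number of pairs still to be
    -- formed, and the value is 0 on lists whose length is not 2m.
    pf : ℕ → List A → Carrier
    pf zero    []       = 1#
    pf zero    (_ ∷ _)  = 0#
    pf (suc m) []       = 0#
    pf (suc m) (v ∷ vs) = expand (λ w ws → ω v w * pf m ws) vs

  module _ {ω : A → A → Carrier} where

    -- The partner of `u` lies before `x`, is `x`, or lies after `x`. Only in the middle group does
    -- `x` leave the remaining list; in the outer groups an induction on the remainder can still act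
    -- on it.
    pf-insert : ∀ m u us x ws → pf ω (suc m) (u ∷ us ++ x ∷ ws) ≈
      expand (λ w us′ → ω u w * pf ω m (us′ ++ x ∷ ws)) us
        + sgn us * (ω u x * pf ω m (us ++ ws) - expand (λ w ws′ → ω u w * pf ω m (us ++ x ∷ ws′)) ws)
    pf-insert m u us x ws = expand-++ (λ w ws′ → ω u w * pf ω m ws′) us (x ∷ ws)

    -- Every term of the expansion uses this slot once: at the head of the list, where `left`
    -- applies, as the partner of an earlier vector, where `right` applies, or in the remainder, by
    -- induction.
    pf-linear : ∀ k x y z →
      (∀ v → ω x v ≈ ω y v + k * ω z v) → (∀ v → ω v x ≈ ω v y + k * ω v z) →
      ∀ m us ws → pf ω m (us ++ x ∷ ws) ≈ pf ω m (us ++ y ∷ ws) + k * pf ω m (us ++ z ∷ ws)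
    pf-linear k x y z left right = go
      where
      zero-case : 0# ≈ 0# + k * 0#
      zero-case = sym (trans (+-identityˡ _) (zeroʳ k))

      scale : ∀ o {p q r} → p ≈ q + k * r → o * p ≈ o * q + k * (o * r)
      scale o eq = trans (*-congˡ eq)
        (solve 4 (λ o q k r → o :* (q :+ k :* r) := o :* q :+ k :* (o :* r)) refl _ _ _ _)

      go : ∀ m us ws → pf ω m (us ++ x ∷ ws) ≈ pf ω m (us ++ y ∷ ws) + k * pf ω m (us ++ z ∷ ws)
      go zero    []       ws = zero-case
      go zero    (u ∷ us) ws = zero-case
      go (suc m) []       ws = expand-linear′ k (λ w ws′ → trans (*-congʳ (left w))
        (solve 4 (λ a k b p → (a :+ k :* b) :* p := a :* p :+ k :* (b :* p)) refl _ _ _ _)) ws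
      go (suc m) (u ∷ us) ws = begin
        pf ω (suc m) (u ∷ us ++ x ∷ ws)
          ≈⟨ pf-insert m u us x ws ⟩
        X x + sgn us * (ω u x * p₀ - Y x)
          ≈⟨ +-cong (expand-linear′ k (λ w us′ → scale (ω u w) (go m us′ ws)) us)
               (*-congˡ (+-cong (*-congʳ (right u)) (-‿cong (expand-linear′ k (λ w ws′ → scale (ω u w) (go m us ws′)) ws)))) ⟩
        X y + k * X z + sgn us * ((ω u y + k * ω u z) * p₀ - (Y y + k * Y z))
          ≈⟨ +-congˡ (*-congˡ (+-congˡ (trans (sym (-‿+-comm _ _)) (+-congˡ (-‿distribʳ-* _ _))))) ⟩
        X y + k * X z + sgn us * ((ω u y + k * ω u z) * p₀ + (- Y y + k * - Y z))
          ≈⟨ solve 9 (λ a k b s o o′ p c d →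
               a :+ k :* b :+ s :* ((o :+ k :* o′) :* p :+ (c :+ k :* d)) :=
               a :+ s :* (o :* p :+ c) :+ k :* (b :+ s :* (o′ :* p :+ d))) refl _ _ _ _ _ _ _ _ _ ⟩
        X y + sgn us * (ω u y * p₀ - Y y) + k * (X z + sgn us * (ω u z * p₀ - Y z))
          ≈⟨ +-cong (pf-insert m u us y ws) (*-congˡ (pf-insert m u us z ws)) ⟨
        pf ω (suc m) (u ∷ us ++ y ∷ ws) + k * pf ω (suc m) (u ∷ us ++ z ∷ ws) ∎
        where
        p₀ = pf ω m (us ++ ws)
        X = λ v → expand (λ w us′ → ω u w * pf ω m (us′ ++ v ∷ ws)) us
        Y = λ v → expand (λ w ws′ → ω u w * pf ω m (us ++ v ∷ ws′)) ws

    -- With `f = ω x` and `g = ω y` this is what the expansion along two leading vectors `x`, `y`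
    -- contributes when they are not partners of each other: `x` takes its partner first, then `y`.
    expand₂ : (f g : A → Carrier) (h : List A → Carrier) → List A → Carrier
    expand₂ f g h = expand λ x ys → f x * expand (λ y zs → g y * h zs) ys

    -- Separates the choices that involve the head `x`. Taken first it has sign plus; taken second,
    -- after a later entry, it has sign minus. If both entries come from `xs`, each passes `x` and
    -- the two signs cancel.
    expand₂-∷ : ∀ f g h x xs → expand₂ f g h (x ∷ xs) ≈
      f x * expand (λ y zs → g y * h zs) xs - g x * expand (λ y zs → f y * h zs) xs
        + expand₂ f g (λ zs → h (x ∷ zs)) xs
    expand₂-∷ f g h x xs = begin
      f x * q₀ - expand (λ y ys → f y * (g x * h ys - E ys)) xs
        ≈⟨ +-congˡ (-‿cong (expand-linear′ (- 1#) (λ y ys → begin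
             f y * (g x * h ys - E ys)               ≈⟨ *-congˡ (+-congˡ (-1*x≈-x _)) ⟨
             f y * (g x * h ys + - 1# * E ys)
               ≈⟨ solve 5 (λ f g h m e → f :* (g :* h :+ m :* e) := g :* (f :* h) :+ m :* (f :* e)) refl _ _ _ _ _ ⟩
             g x * (f y * h ys) + - 1# * (f y * E ys) ∎) xs)) ⟩
      f x * q₀ - (expand (λ y ys → g x * (f y * h ys)) xs + - 1# * D)
        ≈⟨ +-congˡ (-‿cong (+-cong (expand-* (g x) _ xs) (-1*x≈-x D))) ⟩
      f x * q₀ - (g x * p₀ - D)
        ≈⟨ +-congˡ (-[x-y]≈-x+y (g x * p₀) D) ⟩
      f x * q₀ + (- (g x * p₀) + D)
        ≈⟨ +-assoc _ _ _ ⟨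
      f x * q₀ - g x * p₀ + D ∎
      where
      p₀ = expand (λ y zs → f y * h zs) xs
      q₀ = expand (λ y zs → g y * h zs) xs
      D = expand₂ f g (λ zs → h (x ∷ zs)) xs
      E = λ ys → expand (λ z zs → g z * h (x ∷ zs)) ys

    -- The two terms with the head cancel each other outright. Deducing this from `expand₂-swap`
    -- would require dividing by 2.
    expand₂-diagonal : ∀ f h xs → expand₂ f f h xs ≈ 0#
    expand₂-diagonal f h []       = refl
    expand₂-diagonal f h (x ∷ xs) = begin
      expand₂ f f h (x ∷ xs)                        ≈⟨ expand₂-∷ f f h x xs ⟩
      _ - _ + expand₂ f f (λ zs → h (x ∷ zs)) xs    ≈⟨ +-cong (-‿inverseʳ _) (expand₂-diagonal f _ xs) ⟩
      0# + 0#                                       ≈⟨ +-identityˡ 0# ⟩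
      0#                                            ∎

    expand₂-swap : ∀ f g h xs → expand₂ f g h xs ≈ - expand₂ g f h xs
    expand₂-swap f g h []       = sym -0≈0
    expand₂-swap f g h (x ∷ xs) = begin
      expand₂ f g h (x ∷ xs)       ≈⟨ expand₂-∷ f g h x xs ⟩
      p - q + D f g                ≈⟨ +-cong (-[x-y]≈y-x q p) (sym (expand₂-swap f g _ xs)) ⟨
      - (q - p) + - D g f          ≈⟨ -‿+-comm _ _ ⟩
      - (q - p + D g f)            ≈⟨ -‿cong (expand₂-∷ g f h x xs) ⟨
      - expand₂ g f h (x ∷ xs)     ∎
      where
      p = f x * expand (λ y zs → g y * h zs) xs
      q = g x * expand (λ y zs → f y * h zs) xs
      D = λ f g → expand₂ f g (λ zs → h (x ∷ zs)) xs

    -- If `u` comes first and is matched elsewhere, `x` and `y` stay adjacent in the remainder. If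
    -- `u` is matched with one of them, exchanging them moves that partner by one position and so
    -- flips the sign. If they lead the list, either they are partners and skewness applies, or
    -- `expand₂-swap` does.
    pf-swap : (∀ x y → ω x y ≈ - ω y x) →
      ∀ m us x y ws → pf ω m (us ++ x ∷ y ∷ ws) ≈ - pf ω m (us ++ y ∷ x ∷ ws)
    pf-swap skew zero          []       x y ws = sym -0≈0
    pf-swap skew zero          (u ∷ us) x y ws = sym -0≈0
    pf-swap skew (suc m) [] x y ws = begin
      ω x y * pf ω m ws - Z m x y    ≈⟨ +-cong (trans (*-congʳ (skew x y)) (sym (-‿distribˡ-* _ _))) (-‿cong (Z-swap m)) ⟩
      - (ω y x * pf ω m ws) - - Z m y x
                                     ≈⟨ -‿+-comm _ _ ⟩
      - (ω y x * pf ω m ws - Z m y x) ∎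
      where
      Z = λ m x y → expand (λ w ws′ → ω x w * pf ω m (y ∷ ws′)) ws
      -- With no pair left to form, the second leading vector stays unmatched and both sides are 0.
      Z-swap : ∀ m → Z m x y ≈ - Z m y x
      Z-swap zero    = trans (expand-≈0 (λ _ _ → zeroʳ _) ws)
        (trans (sym -0≈0) (-‿cong (sym (expand-≈0 (λ _ _ → zeroʳ _) ws))))
      Z-swap (suc m) = expand₂-swap (ω x) (ω y) (pf ω m) ws
    pf-swap skew (suc m) (u ∷ us) x y ws = begin
      pf ω (suc m) (u ∷ us ++ x ∷ y ∷ ws)
        ≈⟨ pf-insert m u us x (y ∷ ws) ⟩
      X x y + sgn us * (a - (b - Z x y))
        ≈⟨ +-cong (X-swap us) (*-congˡ (+-congˡ (trans (-[x-y]≈-x+y b _) (+-congˡ (Z-swap ws))))) ⟩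
      - X y x + sgn us * (a + (- b - Z y x))
        ≈⟨ +-congˡ (*-congˡ (begin
             a + (- b - Z y x)      ≈⟨ solve 3 (λ a b z → a :+ (b :+ z) := b :+ (a :+ z)) refl _ _ _ ⟩
             - b + (a - Z y x)      ≈⟨ +-congˡ (-‿involutive _) ⟨
             - b + - - (a - Z y x)  ≈⟨ -‿+-comm _ _ ⟩
             - (b - (a - Z y x))    ∎)) ⟩
      - X y x + sgn us * - (b - (a - Z y x))
        ≈⟨ +-congˡ (-‿distribʳ-* _ _) ⟨
      - X y x - sgn us * (b - (a - Z y x))
        ≈⟨ -‿+-comm _ _ ⟩
      - (X y x + sgn us * (b - (a - Z y x)))
        ≈⟨ -‿cong (pf-insert m u us y (x ∷ ws)) ⟨
      - pf ω (suc m) (u ∷ us ++ y ∷ x ∷ ws) ∎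
      where
      a = ω u x * pf ω m (us ++ y ∷ ws)
      b = ω u y * pf ω m (us ++ x ∷ ws)
      X = λ x y → expand (λ w us′ → ω u w * pf ω m (us′ ++ x ∷ y ∷ ws)) us
      Z = λ x y → expand (λ w ws′ → ω u w * pf ω m (us ++ x ∷ y ∷ ws′)) ws
      X-swap = expand-neg λ w us′ → trans (*-congˡ (pf-swap skew m us′ x y ws)) (sym (-‿distribʳ-* _ _))
      Z-swap = expand-neg λ w ws′ → trans (*-congˡ (pf-swap skew m us x y ws′)) (sym (-‿distribʳ-* _ _))

    -- An earlier `u` meets the two copies at consecutive positions with equal remainders, so these
    -- terms cancel. When the copies lead, `ω x x` removes the term pairing them and
    -- `expand₂-diagonal` the others.
    pf-double : ∀ m us x ws → ω x x ≈ 0# → pf ω m (us ++ x ∷ x ∷ ws) ≈ 0#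
    pf-double zero    []       x ws ωxx≈0 = refl
    pf-double zero    (u ∷ us) x ws ωxx≈0 = refl
    pf-double (suc m) []       x ws ωxx≈0 = begin
      ω x x * pf ω m ws - Z m     ≈⟨ +-cong (trans (*-congʳ ωxx≈0) (zeroˡ _)) (trans (-‿cong (Z≈0 m)) -0≈0) ⟩
      0# + 0#                     ≈⟨ +-identityˡ 0# ⟩
      0#                          ∎
      where
      Z = λ m → expand (λ w ws′ → ω x w * pf ω m (x ∷ ws′)) ws
      Z≈0 : ∀ m → Z m ≈ 0#
      Z≈0 zero    = expand-≈0 (λ _ _ → zeroʳ _) ws
      Z≈0 (suc m) = expand₂-diagonal (ω x) (pf ω m) ws
    pf-double (suc m) (u ∷ us) x ws ωxx≈0 = begin
      pf ω (suc m) (u ∷ us ++ x ∷ x ∷ ws)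
        ≈⟨ pf-insert m u us x (x ∷ ws) ⟩
      X + sgn us * (a - (a - Z))
        ≈⟨ +-cong X≈0 (*-congˡ (+-congˡ (trans (-[x-y]≈-x+y a Z) (trans (+-congˡ Z≈0) (+-identityʳ _))))) ⟩
      0# + sgn us * (a - a)
        ≈⟨ trans (+-identityˡ _) (trans (*-congˡ (-‿inverseʳ a)) (zeroʳ _)) ⟩
      0# ∎
      where
      a = ω u x * pf ω m (us ++ x ∷ ws)
      X = expand (λ w us′ → ω u w * pf ω m (us′ ++ x ∷ x ∷ ws)) us
      Z = expand (λ w ws′ → ω u w * pf ω m (us ++ x ∷ x ∷ ws′)) ws
      X≈0 = expand-≈0 (λ w us′ → trans (*-congˡ (pf-double m us′ x ws ωxx≈0)) (zeroʳ _)) us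
      Z≈0 = expand-≈0 (λ w ws′ → trans (*-congˡ (pf-double m us x ws′ ωxx≈0)) (zeroʳ _)) ws

    -- Transpositions carry `x` to the right until it stands next to its copy.
    pf-repeated : (∀ x y → ω x y ≈ - ω y x) → ∀ x → ω x x ≈ 0# →
      ∀ m us {ws} → x ∈ ws → pf ω m (us ++ x ∷ ws) ≈ 0#
    pf-repeated skew x ωxx≈0 m us {x ∷ ws} (here ≡.refl) = pf-double m us x ws ωxx≈0
    pf-repeated skew x ωxx≈0 m us {w ∷ ws} (there x∈ws)  = begin
      pf ω m (us ++ x ∷ w ∷ ws)       ≈⟨ pf-swap skew m us x w ws ⟩
      - pf ω m (us ++ w ∷ x ∷ ws)     ≡⟨ ≡.cong (λ vs → - pf ω m vs) (List.++-assoc us (w ∷ []) (x ∷ ws)) ⟨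
      - pf ω m ((us ∷ʳ w) ++ x ∷ ws)  ≈⟨ -‿cong (pf-repeated skew x ωxx≈0 m (us ∷ʳ w) x∈ws) ⟩
      - 0#                            ≈⟨ -0≈0 ⟩
      0#                              ∎

-- Pfaffians with mutually isotropic vectors, and the shear

module Isotropic {c ℓ} (R : CommutativeRing c ℓ) where

  open CommutativeRing R hiding (zero)
  open Pfaffian R
  open import Algebra.Properties.Ring ring using (-1*x≈-x; -‿distribʳ-*)
  open import Algebra.Properties.AbelianGroup +-abelianGroup
    using () renaming (⁻¹-∙-comm to -‿+-comm; ⁻¹-involutive to -‿involutive)
  open import Algebra.Properties.Semiring.Exp semiring using (^-homo-*)
  open import Algebra.Solver.Ring.NaturalCoefficients.Default commutativeSemiring
    using (solve; _:=_; _:+_; _:*_)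
  open import Relation.Binary.Reasoning.Setoid setoid

  expand-map : ∀ (f : I → A) (g : A → List A → Carrier) xs →
    expand g (map f xs) ≈ expand (λ x ys → g (f x) (map f ys)) xs
  expand-map f g []       = refl
  expand-map f g (x ∷ xs) = +-congˡ (-‿cong (expand-map f (λ y ys → g y (f x ∷ ys)) xs))

  pf-map : ∀ (f : I → A) (ω : A → A → Carrier) m xs →
    pf ω m (map f xs) ≈ pf (λ x y → ω (f x) (f y)) m xs
  pf-map f ω zero    []       = refl
  pf-map f ω zero    (x ∷ xs) = refl
  pf-map f ω (suc m) []       = refl
  pf-map f ω (suc m) (x ∷ xs) =
    trans (expand-map f _ xs) (expand-cong′ (λ y ys → *-congˡ (pf-map f ω m ys)) xs)

  -- The determinant by expansion along the first row, with rows and columns given by lists so that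
  -- its recursion runs parallel to that of `pf`. It is 0 unless the two lists have equal length, as
  -- `pf` is on lists of the wrong length.
  dt : (I → J → Carrier) → List I → List J → Carrier
  dt N []       []       = 1#
  dt N []       (_ ∷ _)  = 0#
  dt N (i ∷ is) js       = expand (λ j js′ → N i j * dt N is js′) js

  dt-map : ∀ (f : J → A) (N : I → A → Carrier) is js →
    dt N is (map f js) ≈ dt (λ i j → N i (f j)) is js
  dt-map f N []       []       = refl
  dt-map f N []       (_ ∷ _)  = refl
  dt-map f N (i ∷ is) js       =
    trans (expand-map f _ js) (expand-cong′ (λ j js′ → *-congˡ (dt-map f N is js′)) js)

  module _ {ω : A → A → Carrier} (p : I → A) (p-isotropic : ∀ i j → ω (p i) (p j) ≈ 0#) where

    -- A partner among the isotropic vectors contributes 0, and every partner in `vs` stands behind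
    -- all of `map p is`, which gives the common factor `sgn is`.
    pf-isotropic-∷ : ∀ m i is vs → pf ω (suc m) (map p (i ∷ is) ++ vs) ≈
      sgn is * expand (λ v vs′ → ω (p i) v * pf ω m (map p is ++ vs′)) vs
    pf-isotropic-∷ m i is vs = begin
      expand (λ v vs′ → ω (p i) v * pf ω m vs′) (map p is ++ vs)
        ≈⟨ expand-++ _ (map p is) vs ⟩
      expand (λ v is′ → ω (p i) v * pf ω m (is′ ++ vs)) (map p is) + sgn (map p is) * E
        ≈⟨ +-congʳ (trans (expand-map p _ is)
             (expand-≈0 (λ j _ → trans (*-congʳ (p-isotropic i j)) (zeroˡ _)) is)) ⟩
      0# + sgn (map p is) * E
        ≈⟨ +-identityˡ _ ⟩
      sgn (map p is) * E
        ≡⟨ ≡.cong (λ k → sign R k * E) (List.length-map p is) ⟩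
      sgn is * E ∎
      where E = expand (λ v vs′ → ω (p i) v * pf ω m (map p is ++ vs′)) vs

    -- Each isotropic vector contributes a sign for every later one, which makes one sign per pair,
    -- n choose 2 in all. The positions within `vs` produce the signs of the determinant.
    pf-isotropic : ∀ is vs → pf ω (length is) (map p is ++ vs) ≈
      sign R (length is C 2) * dt (λ i → ω (p i)) is vs
    pf-isotropic []       []       = sym (*-identityˡ _)
    pf-isotropic []       (_ ∷ _)  = sym (zeroʳ _)
    pf-isotropic (i ∷ is) vs       = begin
      pf ω (suc k) (map p (i ∷ is) ++ vs)
        ≈⟨ pf-isotropic-∷ k i is vs ⟩
      sgn is * expand (λ v vs′ → ω (p i) v * pf ω k (map p is ++ vs′)) vs
        ≈⟨ *-congˡ (expand-cong′ (λ v vs′ → trans (*-congˡ (pf-isotropic is vs′))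
             (solve 3 (λ a s d → a :* (s :* d) := s :* (a :* d)) refl _ _ _)) vs) ⟩
      sgn is * expand (λ v vs′ → sign R (k C 2) * (ω (p i) v * dt N is vs′)) vs
        ≈⟨ *-congˡ (expand-* _ _ vs) ⟩
      sgn is * (sign R (k C 2) * dt N (i ∷ is) vs)
        ≈⟨ *-assoc _ _ _ ⟨
      sgn is * sign R (k C 2) * dt N (i ∷ is) vs
        ≈⟨ *-congʳ (^-homo-* (- 1#) k (k C 2)) ⟨
      sign R (k ℕ.+ k C 2) * dt N (i ∷ is) vs
        ≡⟨ ≡.cong (λ e → sign R e * dt N (i ∷ is) vs) binomial ⟩
      sign R (suc k C 2) * dt N (i ∷ is) vs ∎
      where
      k = length is
      N = λ i → ω (p i)
      binomial : k ℕ.+ k C 2 ≡ suc k C 2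
      binomial = ≡.trans (≡.cong (ℕ._+ k C 2) (≡.sym (nC1≡n k))) (nCk+nC[k+1]≡[n+1]C[k+1] k 1)

    -- Expanding along a row in reversed order costs (-1)^(|vs| - 1), and passing the later
    -- isotropic vectors costs (-1)^|is|. The lengths agree at every stage of the recursion, so
    -- these signs cancel row by row.
    pf-isotropic-reverse : ∀ is vs → length is ≡ length vs →
      pf ω (length is) (map p is ++ reverse vs) ≈ dt (λ i → ω (p i)) is vs
    pf-isotropic-reverse []       []       eq = refl
    pf-isotropic-reverse (i ∷ is) vs@(_ ∷ _) eq = begin
      pf ω (suc k) (map p (i ∷ is) ++ reverse vs)
        ≈⟨ pf-isotropic-∷ k i is (reverse vs) ⟩
      sgn is * E
        -- Turns `sgn is` into minus the sign of a list one longer; that list is as long as `vs`, as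
        -- `expand-reverse` requires.
        ≈⟨ -‿involutive _ ⟨
      - - (sgn is * E)
        ≈⟨ -‿cong (trans (*-assoc _ _ _) (-1*x≈-x _)) ⟨
      - (sgn (i ∷ is) * E)
        ≡⟨ ≡.cong (λ k → - (sign R k * E)) eq ⟩
      - (sgn vs * E)
        ≈⟨ -‿cong (expand-reverse _ vs) ⟩
      - - expand (λ v vs′ → ω (p i) v * pf ω k (map p is ++ reverse vs′)) vs
        ≈⟨ -‿involutive _ ⟩
      expand (λ v vs′ → ω (p i) v * pf ω k (map p is ++ reverse vs′)) vs
        -- The splitting of `vs` supplied by `expand-cong` is what shows that the shortened lists
        -- still have equal length.
        ≈⟨ expand-cong {xs = vs} {g = λ v vs′ → ω (p i) v * pf ω k (map p is ++ reverse vs′)}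
             {h = λ v vs′ → ω (p i) v * dt (λ i → ω (p i)) is vs′} (λ as x bs vs≡ → *-congˡ (pf-isotropic-reverse is (as ++ bs)
             (ℕ.suc-injective (≡.trans eq (≡.trans (≡.cong length vs≡) (List.length-++-sucʳ as x bs)))))) ⟩
      dt (λ i → ω (p i)) (i ∷ is) vs ∎
      where
      k = length is
      E = expand (λ v vs′ → ω (p i) v * pf ω k (map p is ++ vs′)) (reverse vs)

  -- `A` is a bare set of indices for vectors and has no addition. The sums are therefore adjoined
  -- as formal symbols, and the form is extended to them bilinearly.
  module Shear {ω : A → A → Carrier} (skew : ∀ x y → ω x y ≈ - ω y x)
               (t b : I → A) (b-isotropic : ∀ i → ω (b i) (b i) ≈ 0#) (k : Carrier) where

    -- inj₂ i stands for the vector t i + k b i.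
    ω̂ˡ : A ⊎ I → A → Carrier
    ω̂ˡ (inj₁ u) v = ω u v
    ω̂ˡ (inj₂ i) v = ω (t i) v + k * ω (b i) v

    ω̂ : A ⊎ I → A ⊎ I → Carrier
    ω̂ x (inj₁ v) = ω̂ˡ x v
    ω̂ x (inj₂ i) = ω̂ˡ x (t i) + k * ω̂ˡ x (b i)

    ω̂-linearˡ : ∀ i x → ω̂ (inj₂ i) x ≈ ω̂ (inj₁ (t i)) x + k * ω̂ (inj₁ (b i)) x
    ω̂-linearˡ i (inj₁ v) = refl
    ω̂-linearˡ i (inj₂ j) =
      solve 5 (λ k tt bt tb bb → tt :+ k :* bt :+ k :* (tb :+ k :* bb) :=
                                 tt :+ k :* tb :+ k :* (bt :+ k :* bb)) refl _ _ _ _ _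

    combine-neg : ∀ {x y x′ y′} → x ≈ - x′ → y ≈ - y′ → x + k * y ≈ - (x′ + k * y′)
    combine-neg x≈ y≈ = trans (+-cong x≈ (trans (*-congˡ y≈) (sym (-‿distribʳ-* _ _)))) (-‿+-comm _ _)

    ω̂-skew : ∀ x y → ω̂ x y ≈ - ω̂ y x
    ω̂-skew (inj₁ u) (inj₁ v) = skew u v
    ω̂-skew (inj₁ u) (inj₂ i) = combine-neg (skew u (t i)) (skew u (b i))
    ω̂-skew (inj₂ i) (inj₁ v) = combine-neg (skew (t i) v) (skew (b i) v)
    ω̂-skew (inj₂ i) (inj₂ j) = trans (ω̂-linearˡ i (inj₂ j))
      (combine-neg (ω̂-skew (inj₁ (t i)) (inj₂ j)) (ω̂-skew (inj₁ (b i)) (inj₂ j)))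

    -- Replacing `t i` by the sheared vector adds `k` times a Pfaffian with `b i` in that place;
    -- `b i` occurs again in `vs`, so this vanishes. The vectors already replaced accumulate in
    -- `us`.
    pf-shear : ∀ m us is {vs} → (∀ i → inj₁ (b i) ∈ vs) →
      pf ω̂ m (us ++ map (inj₁ ∘ t) is ++ vs) ≈ pf ω̂ m (us ++ map inj₂ is ++ vs)
    pf-shear m us []       b∈vs = refl
    pf-shear m us (i ∷ is) {vs} b∈vs = begin
      pf ω̂ m (us ++ inj₁ (t i) ∷ ws)
        ≈⟨ trans (+-congˡ (trans (*-congˡ (pf-repeated ω̂-skew _ (b-isotropic i) m us
             (∈-++⁺ʳ (map (inj₁ ∘ t) is) (b∈vs i)))) (zeroʳ k))) (+-identityʳ _) ⟨
      pf ω̂ m (us ++ inj₁ (t i) ∷ ws) + k * pf ω̂ m (us ++ inj₁ (b i) ∷ ws)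
        ≈⟨ pf-linear k (inj₂ i) (inj₁ (t i)) (inj₁ (b i)) (ω̂-linearˡ i) (λ _ → refl) m us ws ⟨
      pf ω̂ m (us ++ inj₂ i ∷ ws)
        ≡⟨ ≡.cong (pf ω̂ m) (List.++-assoc us (inj₂ i ∷ []) ws) ⟨
      pf ω̂ m ((us ∷ʳ inj₂ i) ++ ws)
        ≈⟨ pf-shear m (us ∷ʳ inj₂ i) is b∈vs ⟩
      pf ω̂ m ((us ∷ʳ inj₂ i) ++ map inj₂ is ++ vs)
        ≡⟨ ≡.cong (pf ω̂ m) (List.++-assoc us (inj₂ i ∷ []) (map inj₂ is ++ vs)) ⟩
      pf ω̂ m (us ++ inj₂ i ∷ map inj₂ is ++ vs) ∎
      where ws = map (inj₁ ∘ t) is ++ vs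

    pf-shear₁ : ∀ m is {vs} → (∀ i → b i ∈ vs) →
      pf ω m (map t is ++ vs) ≈ pf ω̂ m (map inj₂ is ++ map inj₁ vs)
    pf-shear₁ m is {vs} b∈vs = begin
      pf ω m (map t is ++ vs)                          ≈⟨ pf-map inj₁ ω̂ m (map t is ++ vs) ⟨
      pf ω̂ m (map inj₁ (map t is ++ vs))               ≡⟨ ≡.cong (pf ω̂ m) (≡.trans (List.map-++ inj₁ (map t is) vs)
                                                            (≡.cong (_++ map inj₁ vs) (≡.sym (List.map-∘ is)))) ⟩
      pf ω̂ m (map (inj₁ ∘ t) is ++ map inj₁ vs)        ≈⟨ pf-shear m [] is (∈-map⁺ inj₁ ∘ b∈vs) ⟩
      pf ω̂ m (map inj₂ is ++ map inj₁ vs)              ∎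

    module _ (isotropic : ∀ i j → ω̂ (inj₂ i) (inj₂ j) ≈ 0#) where

      -- Here the bottom vectors are read in the order of the columns; in `pf≈dt-reverse` they are
      -- read in the opposite order.
      pf≈dt : ∀ is {vs} → (∀ i → b i ∈ vs) → pf ω (length is) (map t is ++ vs) ≈
        sign R (length is C 2) * dt (λ i v → ω (t i) v + k * ω (b i) v) is vs
      pf≈dt is {vs} b∈vs = trans (pf-shear₁ (length is) is b∈vs)
        (trans (pf-isotropic inj₂ isotropic is (map inj₁ vs)) (*-congˡ (dt-map inj₁ _ is vs)))

      pf≈dt-reverse : ∀ is {vs} → (∀ i → b i ∈ reverse vs) → length is ≡ length vs →
        pf ω (length is) (map t is ++ reverse vs) ≈ dt (λ i v → ω (t i) v + k * ω (b i) v) is vs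
      pf≈dt-reverse is {vs} b∈vs eq = begin
        pf ω (length is) (map t is ++ reverse vs)
          ≈⟨ pf-shear₁ (length is) is b∈vs ⟩
        pf ω̂ (length is) (map inj₂ is ++ map inj₁ (reverse vs))
          ≡⟨ ≡.cong (λ ws → pf ω̂ (length is) (map inj₂ is ++ ws)) (List.reverse-map inj₁ vs) ⟩
        pf ω̂ (length is) (map inj₂ is ++ reverse (map inj₁ vs))
          ≈⟨ pf-isotropic-reverse inj₂ isotropic is (map inj₁ vs) (≡.trans eq (≡.sym (List.length-map inj₁ vs))) ⟩
        dt (λ i → ω̂ (inj₂ i)) is (map inj₁ vs)
          ≈⟨ dt-map inj₁ _ is vs ⟩
        dt (λ i v → ω (t i) v + k * ω (b i) v) is vs ∎

-- Determinants

count-map : (P? : Decidable P) (f : I → A) (xs : List I) →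
  length (filter P? (map f xs)) ≡ length (filter (λ x → P? (f x)) xs)
count-map P? f []       = ≡.refl
count-map P? f (x ∷ xs) with P? (f x)
... | yes _ = ≡.cong suc (count-map P? f xs)
... | no  _ = count-map P? f xs

count-++ : (P? : Decidable P) (xs ys : List A) →
  length (filter P? (xs ++ ys)) ≡ length (filter P? xs) ℕ.+ length (filter P? ys)
count-++ P? xs ys = ≡.trans (≡.cong length (List.filter-++ P? xs ys)) (List.length-++ (filter P? xs))

count-cong : (P? : Decidable P) (Q? : Decidable Q) → (∀ {x} → P x → Q x) → (∀ {x} → Q x → P x) →
  ∀ (xs : List A) → length (filter P? xs) ≡ length (filter Q? xs)
count-cong P? Q? P⇒Q Q⇒P xs = ≡.cong length (List.filter-≐ P? Q? (P⇒Q , Q⇒P) xs)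

unique⇒↭ : Unique xs → Unique ys → (∀ {x} → x ∈ xs → x ∈ ys) → (∀ {x} → x ∈ ys → x ∈ xs) → xs ↭ ys
unique⇒↭ xs! ys! xs⊆ys ys⊆xs = ∼bag⇒↭ (unique∧set⇒bag xs! ys! (mk⇔ xs⊆ys ys⊆xs))

-- Pairs by position, without reference to an order on `A`. This serves both for increasing pairs of
-- indices and for vertices listed along the boundary.
orderedPairs : List A → List (A × A)
orderedPairs []       = []
orderedPairs (x ∷ xs) = map (x ,_) xs ++ orderedPairs xs

orderedPairs-map : (f : I → A) (xs : List I) →
  orderedPairs (map f xs) ≡ map (Product.map f f) (orderedPairs xs)
orderedPairs-map f []       = ≡.refl
orderedPairs-map f (x ∷ xs) = begin
  map (f x ,_) (map f xs) ++ orderedPairs (map f xs)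
    ≡⟨ ≡.cong₂ _++_ (≡.trans (≡.sym (List.map-∘ xs)) (List.map-∘ xs)) (orderedPairs-map f xs) ⟩
  map (Product.map f f) (map (x ,_) xs) ++ map (Product.map f f) (orderedPairs xs)
    ≡⟨ List.map-++ (Product.map f f) (map (x ,_) xs) (orderedPairs xs) ⟨
  map (Product.map f f) (map (x ,_) xs ++ orderedPairs xs) ∎
  where open ≡.≡-Reasoning

increasing? : Decidable (uncurry (_<_ {n} {n}))
increasing? (i , j) = i <? j

-- In an increasing list the head is the second component of no increasing pair. `drop-column`
-- discards its column, after which the product is one over the tail alone.
filter-increasing : {xs : List (Fin n)} → AllPairs _<_ xs →
  filter increasing? (cartesianProduct xs xs) ≡ orderedPairs xs
filter-increasing []                     = ≡.refl
filter-increasing (_∷_ {x} {xs} x<xs xs<) = begin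
  filter increasing? ((x , x) ∷ map (x ,_) xs ++ cartesianProduct xs (x ∷ xs))
    ≡⟨ List.filter-reject increasing? {x , x} {map (x ,_) xs ++ cartesianProduct xs (x ∷ xs)} (ℕ.<-irrefl ≡.refl) ⟩
  filter increasing? (map (x ,_) xs ++ cartesianProduct xs (x ∷ xs))
    ≡⟨ List.filter-++ increasing? (map (x ,_) xs) _ ⟩
  filter increasing? (map (x ,_) xs) ++ filter increasing? (cartesianProduct xs (x ∷ xs))
    ≡⟨ ≡.cong₂ _++_ (List.filter-all increasing? (All.map⁺ x<xs))
         (≡.trans (drop-column x<xs) (filter-increasing xs<)) ⟩
  map (x ,_) xs ++ orderedPairs xs ∎
  where
  open ≡.≡-Reasoning
  drop-column : ∀ {x} {xs ys : List (Fin _)} → All (x <_) xs →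
    filter increasing? (cartesianProduct xs (x ∷ ys)) ≡ filter increasing? (cartesianProduct xs ys)
  drop-column []                                    = ≡.refl
  drop-column {x} {ys = ys} (_∷_ {x′} {xs} x<x′ x<xs) = begin
    filter increasing? ((x′ , x) ∷ map (x′ ,_) ys ++ cartesianProduct xs (x ∷ ys))
      ≡⟨ List.filter-reject increasing? {x′ , x} {map (x′ ,_) ys ++ cartesianProduct xs (x ∷ ys)} (ℕ.<-asym x<x′) ⟩
    filter increasing? (map (x′ ,_) ys ++ cartesianProduct xs (x ∷ ys))
      ≡⟨ List.filter-++ increasing? (map (x′ ,_) ys) _ ⟩
    filter increasing? (map (x′ ,_) ys) ++ filter increasing? (cartesianProduct xs (x ∷ ys))
      ≡⟨ ≡.cong (filter increasing? (map (x′ ,_) ys) ++_) (drop-column x<xs) ⟩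
    filter increasing? (map (x′ ,_) ys) ++ filter increasing? (cartesianProduct xs ys)
      ≡⟨ List.filter-++ increasing? (map (x′ ,_) ys) _ ⟨
    filter increasing? (map (x′ ,_) ys ++ cartesianProduct xs ys) ∎

increasingPairs≡orderedPairs : ∀ n → increasingPairs n ≡ orderedPairs (allFin n)
increasingPairs≡orderedPairs n = filter-increasing (AllPairs.tabulate⁺-< id)

increasingPairs-suc : ∀ n → increasingPairs (suc n) ≡
  map (zero ,_) (map suc (allFin n)) ++ map (Product.map suc suc) (increasingPairs n)
increasingPairs-suc n = begin
  increasingPairs (suc n)
    ≡⟨ increasingPairs≡orderedPairs (suc n) ⟩
  orderedPairs (zero ∷ tabulate suc)
    ≡⟨ ≡.cong (λ is → orderedPairs (zero ∷ is)) (List.map-tabulate id suc) ⟨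
  map (zero ,_) (map suc (allFin n)) ++ orderedPairs (map suc (allFin n))
    ≡⟨ ≡.cong (map (zero ,_) (map suc (allFin n)) ++_) (≡.trans (orderedPairs-map suc (allFin n))
         (≡.cong (map (Product.map suc suc)) (≡.sym (increasingPairs≡orderedPairs n)))) ⟩
  map (zero ,_) (map suc (allFin n)) ++ map (Product.map suc suc) (increasingPairs n) ∎
  where open ≡.≡-Reasoning

map-permutation-↭ : (π : Permutation′ n) → map (π ⟨$⟩ʳ_) (allFin n) ↭ allFin n
map-permutation-↭ {n} π = unique⇒↭ (Unique.map⁺ injective (Unique.allFin⁺ n)) (Unique.allFin⁺ n)
  (λ _ → ∈-allFin _)
  (λ {x} _ → ≡.subst (_∈ map (π ⟨$⟩ʳ_) (allFin n)) (inverseʳ π {x}) (∈-map⁺ (π ⟨$⟩ʳ_) (∈-allFin (π ⟨$⟩ˡ x))))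
  where
  injective : ∀ {i j} → π ⟨$⟩ʳ i ≡ π ⟨$⟩ʳ j → i ≡ j
  injective eq = ≡.trans (≡.sym (inverseˡ π)) (≡.trans (≡.cong (π ⟨$⟩ˡ_) eq) (inverseˡ π))

-- `punchIn j` enumerates the values other than `j`, and `toℕ j` of them lie below `j`.
count-punchIn-< : (j : Fin (suc n)) →
  length (filter (λ k → punchIn j k <? j) (allFin n)) ≡ toℕ j
count-punchIn-< {n}     zero    = ≡.cong length (List.filter-none (λ k → suc k <? Fin.zero {n}) {allFin n} (All.universal (λ _ ()) (allFin n)))
count-punchIn-< {suc n} (suc j) = ≡.cong suc (begin
  length (filter (λ k → punchIn (suc j) k <? suc j) (tabulate suc))
    ≡⟨ ≡.cong (λ ks → length (filter (λ k → punchIn (suc j) k <? suc j) ks)) (List.map-tabulate id suc) ⟨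
  length (filter (λ k → punchIn (suc j) k <? suc j) (map suc (allFin n)))
    ≡⟨ count-map (λ k → punchIn (suc j) k <? suc j) suc (allFin n) ⟩
  length (filter (λ k → suc (punchIn j k) <? suc j) (allFin n))
    ≡⟨ count-cong _ _ ℕ.s<s⁻¹ ℕ.s<s (allFin n) ⟩
  length (filter (λ k → punchIn j k <? j) (allFin n))
    ≡⟨ count-punchIn-< j ⟩
  toℕ j ∎)
  where open ≡.≡-Reasoning

punchIn-mono-< : ∀ (i : Fin (suc n)) {j k} → j < k → punchIn i j < punchIn i k
punchIn-mono-< i j<k = ℕ.≰⇒> (λ k≤j → ℕ.<⇒≱ j<k (punchIn-cancel-≤ i _ _ k≤j))

punchIn-cancel-< : ∀ (i : Fin (suc n)) {j k} → punchIn i j < punchIn i k → j < k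
punchIn-cancel-< i j<k = ℕ.≰⇒> (λ k≤j → ℕ.<⇒≱ j<k (punchIn-mono-≤ i _ _ k≤j))

-- The value `j` in first place is inverted with every smaller value, wherever `π` puts it. Among
-- the other places `punchIn j` preserves the order, so their inversions are those of `π`.
inversions-insert : (j : Fin (suc n)) (π : Permutation′ n) →
  inversions (insert zero j π) ≡ toℕ j ℕ.+ inversions π
inversions-insert {n} j π = begin
  length (filter inverted? (increasingPairs (suc n)))
    ≡⟨ ≡.cong (λ ps → length (filter inverted? ps)) (increasingPairs-suc n) ⟩
  length (filter inverted? (map (zero ,_) (map suc (allFin n)) ++ map (Product.map suc suc) (increasingPairs n)))
    ≡⟨ count-++ inverted? (map (zero ,_) (map suc (allFin n))) _ ⟩
  length (filter inverted? (map (zero ,_) (map suc (allFin n)))) ℕ.+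
  length (filter inverted? (map (Product.map suc suc) (increasingPairs n)))
    ≡⟨ ≡.cong₂ ℕ._+_ first rest ⟩
  toℕ j ℕ.+ inversions π ∎
  where
  open ≡.≡-Reasoning
  σ = insert zero j π
  inverted? : Decidable (λ ((k , l) : Fin (suc n) × Fin (suc n)) → σ ⟨$⟩ʳ l < σ ⟨$⟩ʳ k)
  inverted? (k , l) = (σ ⟨$⟩ʳ l) <? (σ ⟨$⟩ʳ k)
  first : length (filter inverted? (map (zero ,_) (map suc (allFin n)))) ≡ toℕ j
  first = begin
    length (filter inverted? (map (zero ,_) (map suc (allFin n))))
      ≡⟨ ≡.trans (count-map inverted? (zero ,_) (map suc (allFin n))) (count-map (λ k → inverted? (zero , k)) suc (allFin n)) ⟩
    length (filter (λ k → punchIn j (π ⟨$⟩ʳ k) <? j) (allFin n))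
      ≡⟨ count-map (λ k → punchIn j k <? j) (π ⟨$⟩ʳ_) (allFin n) ⟨
    length (filter (λ k → punchIn j k <? j) (map (π ⟨$⟩ʳ_) (allFin n)))
      ≡⟨ ↭-length (filter-↭ (λ k → punchIn j k <? j) (map-permutation-↭ π)) ⟩
    length (filter (λ k → punchIn j k <? j) (allFin n))
      ≡⟨ count-punchIn-< j ⟩
    toℕ j ∎
  rest : length (filter inverted? (map (Product.map suc suc) (increasingPairs n))) ≡ inversions π
  rest = ≡.trans (count-map inverted? (Product.map suc suc) (increasingPairs n))
    (count-cong _ _ (punchIn-cancel-< j) (punchIn-mono-< j) (increasingPairs n))

-- Finite sums and products, and the determinant expanded along its first row

module Sums {c ℓ} (R : CommutativeRing c ℓ) where

  open CommutativeRing R hiding (zero)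
  open import Algebra.Properties.CommutativeSemigroup *-commutativeSemigroup
    using (interchange; x∙yz≈y∙xz)

  ∑-cong : ∀ {i} {I : Set i} {f g : I → Carrier} → (∀ x → f x ≈ g x) → ∀ xs → ∑ R xs f ≈ ∑ R xs g
  ∑-cong eq []       = refl
  ∑-cong eq (x ∷ xs) = +-cong (eq x) (∑-cong eq xs)

  ∑-++ : ∀ {i} {I : Set i} (f : I → Carrier) xs ys → ∑ R (xs ++ ys) f ≈ ∑ R xs f + ∑ R ys f
  ∑-++ f []       ys = sym (+-identityˡ _)
  ∑-++ f (x ∷ xs) ys = trans (+-congˡ (∑-++ f xs ys)) (sym (+-assoc _ _ _))

  ∑-map : ∀ {i j} {I : Set i} {J : Set j} (h : I → J) (f : J → Carrier) xs →
    ∑ R (map h xs) f ≡ ∑ R xs (λ x → f (h x))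
  ∑-map h f []       = ≡.refl
  ∑-map h f (x ∷ xs) = ≡.cong (f (h x) +_) (∑-map h f xs)

  ∑-*ˡ : ∀ {i} {I : Set i} k (f : I → Carrier) xs → ∑ R xs (λ x → k * f x) ≈ k * ∑ R xs f
  ∑-*ˡ k f []       = sym (zeroʳ k)
  ∑-*ˡ k f (x ∷ xs) = trans (+-congˡ (∑-*ˡ k f xs)) (sym (distribˡ k _ _))

  ∑-cartesianProductWith : ∀ {i j k} {I : Set i} {J : Set j} {K : Set k}
    (_∙_ : I → J → K) (f : K → Carrier) xs ys →
    ∑ R (cartesianProductWith _∙_ xs ys) f ≈ ∑ R xs (λ x → ∑ R ys (λ y → f (x ∙ y)))
  ∑-cartesianProductWith _∙_ f []       ys = refl
  ∑-cartesianProductWith _∙_ f (x ∷ xs) ys = trans (∑-++ f (map (x ∙_) ys) _)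
    (+-cong (reflexive (∑-map (x ∙_) f ys)) (∑-cartesianProductWith _∙_ f xs ys))

  ∏-cong : {f g : I → Carrier} → (∀ x → f x ≈ g x) → ∀ xs → ∏ R xs f ≈ ∏ R xs g
  ∏-cong eq []       = refl
  ∏-cong eq (x ∷ xs) = *-cong (eq x) (∏-cong eq xs)

  ∏-map : (h : I → J) (f : J → Carrier) → ∀ xs →
    ∏ R (map h xs) f ≡ ∏ R xs (λ x → f (h x))
  ∏-map h f []       = ≡.refl
  ∏-map h f (x ∷ xs) = ≡.cong (f (h x) *_) (∏-map h f xs)

  ∏-↭ : {f : I → Carrier} {xs ys : List I} → xs ↭ ys → ∏ R xs f ≈ ∏ R ys f
  ∏-↭ ↭.refl          = refl
  ∏-↭ (↭.prep x p)    = *-congˡ (∏-↭ p)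
  ∏-↭ (↭.swap x y p)  = trans (*-congˡ (*-congˡ (∏-↭ p))) (x∙yz≈y∙xz _ _ _)
  ∏-↭ (↭.trans p q)   = trans (∏-↭ p) (∏-↭ q)

  ∏-* : (f g : I → Carrier) → ∀ xs → ∏ R xs (λ x → f x * g x) ≈ ∏ R xs f * ∏ R xs g
  ∏-* f g []       = sym (*-identityˡ 1#)
  ∏-* f g (x ∷ xs) = trans (*-congˡ (∏-* f g xs)) (interchange _ _ _ _)

  ∏-≈1 : {f : I → Carrier} {xs : List I} → All (λ x → f x ≈ 1#) xs → ∏ R xs f ≈ 1#
  ∏-≈1 []         = refl
  ∏-≈1 (eq ∷ eqs) = trans (*-cong eq (∏-≈1 eqs)) (*-identityˡ 1#)

module Determinant {c ℓ} (R : CommutativeRing c ℓ) where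

  open CommutativeRing R hiding (zero)
  open Pfaffian R
  open Isotropic R
  open Sums R
  open import Algebra.Properties.Ring ring using (-1*x≈-x)
  open import Algebra.Properties.Semiring.Exp semiring using (^-homo-*)
  open import Algebra.Solver.Ring.NaturalCoefficients.Default commutativeSemiring
    using (solve; _:=_; _:+_; _:*_)
  open import Relation.Binary.Reasoning.Setoid setoid

  det-cong : {M N : Matrix R n} → (∀ i j → M i j ≈ N i j) → det R M ≈ det R N
  det-cong {n} eq = ∑-cong (λ π → *-congˡ (∏-cong (λ i → eq i (π ⟨$⟩ʳ i)) (allFin n))) (permutations n)

  -- `permutations (suc n)` is built by choosing the image `j` of the first index, so the Leibniz
  -- sum is already grouped by the entry taken from the first row.
  det-laplace : (M : Matrix R (suc n)) → det R M ≈
    ∑ R (allFin (suc n)) λ j → sign R (toℕ j) * (M zero j * det R (λ i k → M (suc i) (punchIn j k)))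
  det-laplace {n} M = begin
    det R M
      ≈⟨ ∑-cartesianProductWith (insert zero) _ (allFin (suc n)) (permutations n) ⟩
    ∑ R (allFin (suc n)) (λ j → ∑ R (permutations n) (λ π → term (insert zero j π)))
      ≈⟨ ∑-cong (λ j → trans (∑-cong (factor j) (permutations n))
           (trans (∑-*ˡ _ _ (permutations n)) (*-congˡ (∑-*ˡ _ _ (permutations n))))) (allFin (suc n)) ⟩
    ∑ R (allFin (suc n)) (λ j → sign R (toℕ j) * (M zero j * det R (minor j))) ∎
    where
    term : Permutation′ (suc n) → Carrier
    term σ = sign R (inversions σ) * ∏ R (allFin (suc n)) (λ i → M i (σ ⟨$⟩ʳ i))
    minor : Fin (suc n) → Matrix R n
    minor j i k = M (suc i) (punchIn j k)
    factor : ∀ j π → term (insert zero j π) ≈ sign R (toℕ j) * (M zero j *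
      (sign R (inversions π) * ∏ R (allFin n) (λ i → minor j i (π ⟨$⟩ʳ i))))
    factor j π = begin
      sign R (inversions (insert zero j π)) * (M zero j * ∏ R (tabulate suc) entry)
        ≡⟨ ≡.cong₂ (λ k is → sign R k * (M zero j * ∏ R is entry)) (inversions-insert j π)
             (≡.sym (List.map-tabulate id suc)) ⟩
      sign R (toℕ j ℕ.+ inversions π) * (M zero j * ∏ R (map suc (allFin n)) entry)
        ≈⟨ *-cong (^-homo-* (- 1#) (toℕ j) (inversions π)) (*-congˡ (reflexive (∏-map suc entry (allFin n)))) ⟩
      sign R (toℕ j) * sign R (inversions π) * (M zero j * ∏ R (allFin n) (λ i → minor j i (π ⟨$⟩ʳ i)))
        ≈⟨ solve 4 (λ s t m p → s :* t :* (m :* p) := s :* (m :* (t :* p))) refl _ _ _ _ ⟩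
      sign R (toℕ j) * (M zero j * (sign R (inversions π) * ∏ R (allFin n) (λ i → minor j i (π ⟨$⟩ʳ i)))) ∎
      where
      entry : Fin (suc n) → Carrier
      entry i = M i (insert zero j π ⟨$⟩ʳ i)

  -- Passes from lists with an entry deleted to indices: deleting position `j` amounts to
  -- precomposing with `punchIn j`.
  expand-tabulate : ∀ (g : A → List A → Carrier) (f : Fin (suc n) → A) →
    expand g (tabulate f) ≈
    ∑ R (allFin (suc n)) λ j → sign R (toℕ j) * g (f j) (tabulate (λ k → f (punchIn j k)))
  expand-tabulate {n = n} g f = +-cong (sym (*-identityˡ _)) (rest n g f)
    where
    rest : ∀ n (g : A → List A → Carrier) (f : Fin (suc n) → A) →
      - expand (λ y ys → g y (f zero ∷ ys)) (tabulate (f ∘ suc)) ≈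
      ∑ R (tabulate suc) λ j → sign R (toℕ j) * g (f j) (tabulate (λ k → f (punchIn j k)))
    rest zero    g f = trans (sym (-1*x≈-x _)) (zeroʳ _)
    rest (suc n) g f = begin
      - expand (λ y ys → g y (f zero ∷ ys)) (tabulate (f ∘ suc))
        ≈⟨ -1*x≈-x _ ⟨
      - 1# * expand (λ y ys → g y (f zero ∷ ys)) (tabulate (f ∘ suc))
        ≈⟨ *-congˡ (expand-tabulate (λ y ys → g y (f zero ∷ ys)) (f ∘ suc)) ⟩
      - 1# * ∑ R (allFin (suc n)) (λ j → sign R (toℕ j) * summand (suc j))
        ≈⟨ ∑-*ˡ _ _ (allFin (suc n)) ⟨
      ∑ R (allFin (suc n)) (λ j → - 1# * (sign R (toℕ j) * summand (suc j)))
        ≈⟨ ∑-cong (λ j → sym (*-assoc _ _ _)) (allFin (suc n)) ⟩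
      ∑ R (allFin (suc n)) (λ j → sign R (toℕ (suc j)) * summand (suc j))
        ≡⟨ ∑-map suc _ (allFin (suc n)) ⟨
      ∑ R (map suc (allFin (suc n))) (λ j → sign R (toℕ j) * summand j)
        ≡⟨ ≡.cong (λ js → ∑ R js (λ j → sign R (toℕ j) * summand j)) (List.map-tabulate id suc) ⟩
      ∑ R (tabulate suc) (λ j → sign R (toℕ j) * summand j) ∎
      where
      summand : Fin (suc (suc n)) → Carrier
      summand j = g (f j) (tabulate (λ k → f (punchIn j k)))

  -- Arbitrary `r` and `s` let the induction reach the minors, whose columns are indexed through
  -- `punchIn j`.
  det≈dt : ∀ n (N : I → J → Carrier) (r : Fin n → I) (s : Fin n → J) →
    det R (λ i j → N (r i) (s j)) ≈ dt N (tabulate r) (tabulate s)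
  det≈dt zero    N r s = trans (+-identityʳ _) (*-identityˡ _)
  det≈dt (suc n) N r s = begin
    det R (λ i j → N (r i) (s j))
      ≈⟨ det-laplace (λ i j → N (r i) (s j)) ⟩
    ∑ R (allFin (suc n)) (λ j → sign R (toℕ j) * (N (r zero) (s j) * det R (λ i k → N (r (suc i)) (s (punchIn j k)))))
      ≈⟨ ∑-cong (λ j → *-congˡ (*-congˡ (det≈dt n N (r ∘ suc) (λ k → s (punchIn j k))))) (allFin (suc n)) ⟩
    ∑ R (allFin (suc n)) (λ j → sign R (toℕ j) *
      (N (r zero) (s j) * dt N (tabulate (r ∘ suc)) (tabulate (λ k → s (punchIn j k)))))
      ≈⟨ expand-tabulate (λ v vs → N (r zero) v * dt N (tabulate (r ∘ suc)) vs) s ⟨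
    dt N (tabulate r) (tabulate s) ∎

-- Matchings

infix 4 _≺_

-- The order of the vertices along the boundary of the strip: the top row from
-- left to right, then the bottom row from right to left.
_≺_ : Vertex n → Vertex n → Set
_≺_ = _<_ ⊎-< flip _<_

≺-trans : {u v w : Vertex n} → u ≺ v → v ≺ w → u ≺ w
≺-trans = ⊎-<-transitive ℕ.<-trans (flip ℕ.<-trans)

≺-asym : {u v : Vertex n} → u ≺ v → ¬ v ≺ u
≺-asym = ⊎-<-asymmetric ℕ.<-asym ℕ.<-asym

≺⇒≢ : {u v : Vertex n} → u ≺ v → u ≢ v
≺⇒≢ u≺u ≡.refl = ≺-asym u≺u u≺u

-- Of two bottom vertices the one that comes first along the boundary lies further right, so the
-- last clause exchanges them to list the ends of a cap from left to right.
edge : Vertex n → Vertex n → Edge n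
edge (top i)    (top j)    = cup i j
edge (top i)    (bottom j) = arc i j
edge (bottom i) (top j)    = arc j i
edge (bottom i) (bottom j) = cap j i

∈ₑ-edge⁺ : (u w : Vertex n) {v : Vertex n} → v ≡ u ⊎ v ≡ w → v ∈ₑ edge u w
∈ₑ-edge⁺ (top i)    (top j)    = id
∈ₑ-edge⁺ (top i)    (bottom j) = id
∈ₑ-edge⁺ (bottom i) (top j)    = Sum.swap
∈ₑ-edge⁺ (bottom i) (bottom j) = Sum.swap

∈ₑ-edge⁻ : (u w : Vertex n) {v : Vertex n} → v ∈ₑ edge u w → v ≡ u ⊎ v ≡ w
∈ₑ-edge⁻ (top i)    (top j)    = id
∈ₑ-edge⁻ (top i)    (bottom j) = id
∈ₑ-edge⁻ (bottom i) (top j)    = Sum.swap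
∈ₑ-edge⁻ (bottom i) (bottom j) = Sum.swap

∉ₑ-edge : {u v w : Vertex n} → v ≢ u → v ≢ w → ¬ v ∈ₑ edge u w
∉ₑ-edge {u = u} {w = w} v≢u v≢w = Sum.[ v≢u , v≢w ] ∘ ∈ₑ-edge⁻ u w

edge-injectiveʳ : (u : Vertex n) {v w : Vertex n} → edge u v ≡ edge u w → v ≡ w
edge-injectiveʳ (top i)    {top j}    {top k}    ≡.refl = ≡.refl
edge-injectiveʳ (top i)    {bottom j} {bottom k} ≡.refl = ≡.refl
edge-injectiveʳ (bottom i) {top j}    {top k}    ≡.refl = ≡.refl
edge-injectiveʳ (bottom i) {bottom j} {bottom k} ≡.refl = ≡.refl

crosses-sym : (e f : Edge n) → Crosses e f → Crosses f e
crosses-sym (cup i j) (cup k l) = Sum.swap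
crosses-sym (cup i j) (arc t b) = id
crosses-sym (cap i j) (cap k l) = Sum.swap
crosses-sym (cap i j) (arc t b) = id
crosses-sym (arc t b) (cup i j) = id
crosses-sym (arc t b) (cap i j) = id
crosses-sym (arc t b) (arc u c) = Sum.swap

-- This and the next two results treat the three relative positions of two chords with distinct ends
-- when `v` comes first. Since the top row precedes the bottom row, the number of top vertices among
-- the four determines the clause.
crosses-interleaved : {v w x y : Vertex n} → v ≺ x → x ≺ w → w ≺ y →
  Crosses (edge v w) (edge x y)
crosses-interleaved (₁∼₁ p) (₁∼₁ q) (₁∼₁ r) = inj₁ (p , q , r)
crosses-interleaved (₁∼₁ p) (₁∼₁ q) ₁∼₂     = p , q
crosses-interleaved (₁∼₁ p) ₁∼₂     (₂∼₂ r) = inj₁ (p , r)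
crosses-interleaved ₁∼₂     (₂∼₂ q) (₂∼₂ r) = r , q
crosses-interleaved (₂∼₂ p) (₂∼₂ q) (₂∼₂ r) = inj₂ (r , q , p)

¬crosses-nested : {v w x y : Vertex n} → v ≺ x → x ≺ y → y ≺ w →
  ¬ Crosses (edge v w) (edge x y)
¬crosses-nested (₁∼₁ p) (₁∼₁ q) (₁∼₁ r) (inj₁ (_ , _ , s)) = ℕ.<-asym r s
¬crosses-nested (₁∼₁ p) (₁∼₁ q) (₁∼₁ r) (inj₂ (s , _ , _)) = ℕ.<-asym p s
¬crosses-nested (₁∼₁ p) (₁∼₁ q) ₁∼₂     (s , _)            = ℕ.<-asym p s
¬crosses-nested (₁∼₁ p) ₁∼₂     (₂∼₂ r) (inj₁ (_ , s))     = ℕ.<-asym r s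
¬crosses-nested (₁∼₁ p) ₁∼₂     (₂∼₂ r) (inj₂ (s , _))     = ℕ.<-asym p s
¬crosses-nested ₁∼₂     (₂∼₂ q) (₂∼₂ r) (s , _)            = ℕ.<-asym r s
¬crosses-nested (₂∼₂ p) (₂∼₂ q) (₂∼₂ r) (inj₁ (_ , _ , s)) = ℕ.<-asym p s
¬crosses-nested (₂∼₂ p) (₂∼₂ q) (₂∼₂ r) (inj₂ (s , _ , _)) = ℕ.<-asym r s

¬crosses-disjoint : {v w x y : Vertex n} → v ≺ w → w ≺ x → x ≺ y →
  ¬ Crosses (edge v w) (edge x y)
¬crosses-disjoint (₁∼₁ p) (₁∼₁ q) (₁∼₁ r) (inj₁ (_ , s , _)) = ℕ.<-asym q s
¬crosses-disjoint (₁∼₁ p) (₁∼₁ q) (₁∼₁ r) (inj₂ (s , _ , _)) = ℕ.<-asym (ℕ.<-trans p q) s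
¬crosses-disjoint (₁∼₁ p) (₁∼₁ q) ₁∼₂     (_ , s)            = ℕ.<-asym q s
¬crosses-disjoint (₁∼₁ p) ₁∼₂     (₂∼₂ r) ()
¬crosses-disjoint ₁∼₂     (₂∼₂ q) (₂∼₂ r) (_ , s)            = ℕ.<-asym q s
¬crosses-disjoint (₂∼₂ p) (₂∼₂ q) (₂∼₂ r) (inj₁ (s , _ , _)) = ℕ.<-asym (ℕ.<-trans r q) s
¬crosses-disjoint (₂∼₂ p) (₂∼₂ q) (₂∼₂ r) (inj₂ (_ , s , _)) = ℕ.<-asym q s

pairEdges : List (Vertex n) → List (Edge n)
pairEdges vs = map (uncurry edge) (orderedPairs vs)

pairEdges-∷ : (v : Vertex n) (vs : List (Vertex n)) → pairEdges (v ∷ vs) ≡ map (edge v) vs ++ pairEdges vs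
pairEdges-∷ v vs = ≡.trans (List.map-++ (uncurry edge) (map (v ,_) vs) (orderedPairs vs))
  (≡.cong (_++ pairEdges vs) (≡.sym (List.map-∘ vs)))

All-orderedPairs : ∀ {r} {_∼_ : A → A → Set r} → AllPairs _∼_ xs → All (uncurry _∼_) (orderedPairs xs)
All-orderedPairs []           = []
All-orderedPairs (x∼xs ∷ xs∼) = All.++⁺ (All.map⁺ x∼xs) (All-orderedPairs xs∼)

All-pairEdges : ∀ {p} {P : Edge n → Set p} {vs : List (Vertex n)} →
  AllPairs (λ u w → P (edge u w)) vs → All P (pairEdges vs)
All-pairEdges = All.map⁺ ∘ All-orderedPairs

AllPairs-map-All : ∀ {r} {_∼_ : A → A → Set} {_∼′_ : A → A → Set r} →
  (∀ {x y} → P x → P y → x ∼ y → x ∼′ y) → All P xs → AllPairs _∼_ xs → AllPairs _∼′_ xs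
AllPairs-map-All f []         []           = []
AllPairs-map-All f (px ∷ pxs) (x∼xs ∷ xs∼) =
  All.zipWith (λ (py , x∼y) → f px py x∼y) (pxs , x∼xs) ∷ AllPairs-map-All f pxs xs∼

-- Removing the edges at a vertex of a complete graph leaves the complete graph on the others, here
-- even in the same order, so that sums over sublists can be rewritten by an equality of lists.
filter-∌-pairEdges : ∀ as (w : Vertex n) bs → All (w ≢_) (as ++ bs) →
  filter (λ e → ¬? (w ∈ₑ? e)) (pairEdges (as ++ w ∷ bs)) ≡ pairEdges (as ++ bs)
filter-∌-pairEdges []       w bs w∉bs = begin
  filter ∌? (pairEdges (w ∷ bs))                           ≡⟨ ≡.cong (filter ∌?) (pairEdges-∷ w bs) ⟩
  filter ∌? (map (edge w) bs ++ pairEdges bs)              ≡⟨ List.filter-++ ∌? (map (edge w) bs) _ ⟩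
  filter ∌? (map (edge w) bs) ++ filter ∌? (pairEdges bs)
    ≡⟨ ≡.cong₂ _++_
         (List.filter-none ∌? (All.map⁺ (All.universal (λ b ¬p → ¬p (∈ₑ-edge⁺ w b (inj₁ ≡.refl))) bs)))
         (List.filter-all ∌? (All-pairEdges (AllPairs-map-All (λ w≢x w≢y _ → ∉ₑ-edge w≢x w≢y) w∉bs (trivial bs)))) ⟩
  pairEdges bs ∎
  where
  open ≡.≡-Reasoning
  ∌? = λ e → ¬? (w ∈ₑ? e)
  trivial : ∀ (xs : List A) → AllPairs (λ _ _ → ⊤) xs
  trivial []       = []
  trivial (x ∷ xs) = All.universal (λ _ → _) xs ∷ trivial xs
filter-∌-pairEdges (a ∷ as) w bs (w≢a ∷ w∉) = begin
  filter ∌? (pairEdges (a ∷ as ++ w ∷ bs))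
    ≡⟨ ≡.cong (filter ∌?) (pairEdges-∷ a (as ++ w ∷ bs)) ⟩
  filter ∌? (map (edge a) (as ++ w ∷ bs) ++ pairEdges (as ++ w ∷ bs))
    ≡⟨ List.filter-++ ∌? (map (edge a) (as ++ w ∷ bs)) _ ⟩
  filter ∌? (map (edge a) (as ++ w ∷ bs)) ++ filter ∌? (pairEdges (as ++ w ∷ bs))
    ≡⟨ ≡.cong₂ _++_ star (filter-∌-pairEdges as w bs w∉) ⟩
  map (edge a) (as ++ bs) ++ pairEdges (as ++ bs)
    ≡⟨ pairEdges-∷ a (as ++ bs) ⟨
  pairEdges (a ∷ as ++ bs) ∎
  where
  open ≡.≡-Reasoning
  ∌? = λ e → ¬? (w ∈ₑ? e)
  avoid : ∀ {xs} → All (w ≢_) xs → filter ∌? (map (edge a) xs) ≡ map (edge a) xs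
  avoid w∉xs = List.filter-all ∌? (All.map⁺ (All.map (∉ₑ-edge w≢a) w∉xs))
  star : filter ∌? (map (edge a) (as ++ w ∷ bs)) ≡ map (edge a) (as ++ bs)
  star = begin
    filter ∌? (map (edge a) (as ++ w ∷ bs))
      ≡⟨ ≡.trans (≡.cong (filter ∌?) (List.map-++ (edge a) as (w ∷ bs))) (List.filter-++ ∌? (map (edge a) as) _) ⟩
    filter ∌? (map (edge a) as) ++ filter ∌? (edge a w ∷ map (edge a) bs)
      ≡⟨ ≡.cong₂ _++_ (avoid (All.++⁻ˡ as w∉))
           (≡.trans (List.filter-reject ∌? (λ ¬p → ¬p (∈ₑ-edge⁺ a w (inj₂ ≡.refl)))) (avoid (All.++⁻ʳ as w∉))) ⟩
    map (edge a) as ++ map (edge a) bs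
      ≡⟨ List.map-++ (edge a) as bs ⟨
    map (edge a) (as ++ bs) ∎

-- Lets the edges be enumerated in any convenient order. In the `swap` case the pair `e`, `f` is
-- counted once on each side, from opposite ends, and symmetry of `Crosses` equates the counts.
χ-↭ : {μ ν : List (Edge n)} → μ ↭ ν → χ μ ≡ χ ν
χ-↭ ↭.refl         = ≡.refl
χ-↭ (↭.prep e p)   = ≡.cong₂ ℕ._+_ (↭-length (filter-↭ (crosses? e) p)) (χ-↭ p)
χ-↭ {μ = _ ∷ _ ∷ μ} {ν = _ ∷ _ ∷ ν} (↭.swap e f p) = begin
  # e (f ∷ μ) ℕ.+ (# f μ ℕ.+ χ μ)
    ≡⟨ ≡.cong (ℕ._+ (# f μ ℕ.+ χ μ)) (count-++ (crosses? e) (f ∷ []) μ) ⟩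
  # e (f ∷ []) ℕ.+ # e μ ℕ.+ (# f μ ℕ.+ χ μ)
    ≡⟨ ≡.cong₂ ℕ._+_ (≡.cong₂ ℕ._+_ sym-count (↭-length (filter-↭ (crosses? e) p)))
                     (≡.cong₂ ℕ._+_ (↭-length (filter-↭ (crosses? f) p)) (χ-↭ p)) ⟩
  # f (e ∷ []) ℕ.+ # e ν ℕ.+ (# f ν ℕ.+ χ ν)
    ≡⟨ ℕ+.interchange (# f (e ∷ [])) (# e ν) (# f ν) (χ ν) ⟩
  # f (e ∷ []) ℕ.+ # f ν ℕ.+ (# e ν ℕ.+ χ ν)
    ≡⟨ ≡.cong (ℕ._+ (# e ν ℕ.+ χ ν)) (count-++ (crosses? f) (e ∷ []) ν) ⟨
  # f (e ∷ ν) ℕ.+ (# e ν ℕ.+ χ ν) ∎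
  where
  open ≡.≡-Reasoning
  # : Edge _ → List (Edge _) → ℕ
  # e μ = length (filter (crosses? e) μ)
  sym-count : # e (f ∷ []) ≡ # f (e ∷ [])
  sym-count with crosses? e f | crosses? f e
  ... | yes _ | yes _ = ≡.refl
  ... | no  _ | no  _ = ≡.refl
  ... | yes p | no ¬q = contradiction (crosses-sym e f p) ¬q
  ... | no ¬p | yes q = contradiction (crosses-sym f e q) ¬p
χ-↭ (↭.trans p q)  = ≡.trans (χ-↭ p) (χ-↭ q)

degree-↭ : (v : Vertex n) {μ ν : List (Edge n)} → μ ↭ ν → degree v μ ≡ degree v ν
degree-↭ v p = ↭-length (filter-↭ (v ∈ₑ?_) p)

degree-∈ : {v : Vertex n} {e : Edge n} (μ : List (Edge n)) → v ∈ₑ e → degree v (e ∷ μ) ≡ suc (degree v μ)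
degree-∈ {v = v} μ v∈e = ≡.cong length (List.filter-accept (v ∈ₑ?_) v∈e)

degree-∉ : {v : Vertex n} {e : Edge n} (μ : List (Edge n)) → ¬ v ∈ₑ e → degree v (e ∷ μ) ≡ degree v μ
degree-∉ {v = v} μ v∉e = ≡.cong length (List.filter-reject (v ∈ₑ?_) v∉e)

degree-none : {v : Vertex n} {μ : List (Edge n)} → All (λ e → ¬ v ∈ₑ e) μ → degree v μ ≡ 0
degree-none {v = v} v∉μ = ≡.cong length (List.filter-none (v ∈ₑ?_) v∉μ)

degree-some : {v : Vertex n} {μ : List (Edge n)} → Any (v ∈ₑ_) μ → degree v μ ≢ 0
degree-some {v = v} v∈μ eq = ℕ.<⇒≢ (List.filter-some (v ∈ₑ?_) v∈μ) (≡.sym eq)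

-- Perfect matching relative to a list of vertices: the recursion deletes vertices from the list
-- while the type `Edge n` stays fixed.
Covers : List (Vertex n) → List (Edge n) → Set
Covers vs μ = All (λ v → degree v μ ≡ 1) vs

covers? : (vs : List (Vertex n)) → Decidable (Covers vs)
covers? vs μ = All.all? (λ v → degree v μ ℕ.≟ 1) vs

-- Sums over sublists

module SublistSums {c ℓ} (R : CommutativeRing c ℓ) where

  open CommutativeRing R hiding (zero)
  open Sums R
  open import Algebra.Properties.CommutativeSemigroup (CommutativeMonoid.commutativeSemigroup +-commutativeMonoid)
    using (interchange)
  open import Relation.Binary.Reasoning.Setoid setoid

  ∑-≈0 : ∀ {i} {I : Set i} {f : I → Carrier} → (∀ x → f x ≈ 0#) → ∀ xs → ∑ R xs f ≈ 0#
  ∑-≈0 eq []       = refl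
  ∑-≈0 eq (x ∷ xs) = trans (+-cong (eq x) (∑-≈0 eq xs)) (+-identityˡ _)

  ∑-sublists-∷ : (f : List A → Carrier) → ∀ x xs →
    ∑ R (sublists (x ∷ xs)) f ≈ ∑ R (sublists xs) f + ∑ R (sublists xs) (λ μ → f (x ∷ μ))
  ∑-sublists-∷ f x xs = trans (∑-++ f (sublists xs) _)
    (+-congˡ (reflexive (∑-map (x ∷_) f (sublists xs))))

  ∑-sublists-cong : ∀ {p} {P : A → Set p} {f g : List A → Carrier} → All P xs →
    (∀ {μ} → All P μ → f μ ≈ g μ) → ∑ R (sublists xs) f ≈ ∑ R (sublists xs) g
  ∑-sublists-cong []                 eq = +-congʳ (eq [])
  ∑-sublists-cong {xs = x ∷ xs} {f = f} {g} (px ∷ pxs) eq = begin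
    ∑ R (sublists (x ∷ xs)) f
      ≈⟨ ∑-sublists-∷ f x xs ⟩
    ∑ R (sublists xs) f + ∑ R (sublists xs) (λ μ → f (x ∷ μ))
      ≈⟨ +-cong (∑-sublists-cong pxs eq) (∑-sublists-cong pxs (λ pμ → eq (px ∷ pμ))) ⟩
    ∑ R (sublists xs) g + ∑ R (sublists xs) (λ μ → g (x ∷ μ))
      ≈⟨ ∑-sublists-∷ g x xs ⟨
    ∑ R (sublists (x ∷ xs)) g ∎

  ∑-sublists-↭ : {f : List A → Carrier} → (∀ {μ ν} → μ ↭ ν → f μ ≈ f ν) →
    xs ↭ ys → ∑ R (sublists xs) f ≈ ∑ R (sublists ys) f
  ∑-sublists-↭ inv ↭.refl = refl
  ∑-sublists-↭ {f = f} inv (↭.prep {xs} {ys} x p) = begin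
    ∑ R (sublists (x ∷ xs)) f
      ≈⟨ ∑-sublists-∷ f x xs ⟩
    ∑ R (sublists xs) f + ∑ R (sublists xs) (λ μ → f (x ∷ μ))
      ≈⟨ +-cong (∑-sublists-↭ inv p) (∑-sublists-↭ (inv ∘ ↭.prep x) p) ⟩
    ∑ R (sublists ys) f + ∑ R (sublists ys) (λ μ → f (x ∷ μ))
      ≈⟨ ∑-sublists-∷ f x ys ⟨
    ∑ R (sublists (x ∷ ys)) f ∎
  ∑-sublists-↭ {f = f} inv (↭.swap {xs} {ys} x y p) = begin
    ∑ R (sublists (x ∷ y ∷ xs)) f
      ≈⟨ split f x y xs ⟩
    S xs f + S xs (λ μ → f (y ∷ μ)) + (S xs (λ μ → f (x ∷ μ)) + S xs (λ μ → f (x ∷ y ∷ μ)))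
      ≈⟨ +-cong (+-cong (∑-sublists-↭ inv p) (∑-sublists-↭ (inv ∘ ↭.prep y) p))
           (+-cong (∑-sublists-↭ (inv ∘ ↭.prep x) p)
             (trans (∑-sublists-↭ (inv ∘ ↭.prep x ∘ ↭.prep y) p)
               (∑-cong (λ μ → inv (↭.swap x y ↭-refl)) (sublists ys)))) ⟩
    S ys f + S ys (λ μ → f (y ∷ μ)) + (S ys (λ μ → f (x ∷ μ)) + S ys (λ μ → f (y ∷ x ∷ μ)))
      ≈⟨ interchange _ _ _ _ ⟩
    S ys f + S ys (λ μ → f (x ∷ μ)) + (S ys (λ μ → f (y ∷ μ)) + S ys (λ μ → f (y ∷ x ∷ μ)))
      ≈⟨ split f y x ys ⟨
    ∑ R (sublists (y ∷ x ∷ ys)) f ∎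
    where
    S : List _ → (List _ → Carrier) → Carrier
    S xs g = ∑ R (sublists xs) g
    split : ∀ f x y xs → S (x ∷ y ∷ xs) f ≈
      S xs f + S xs (λ μ → f (y ∷ μ)) + (S xs (λ μ → f (x ∷ μ)) + S xs (λ μ → f (x ∷ y ∷ μ)))
    split f x y xs = trans (∑-sublists-∷ f x (y ∷ xs))
      (+-cong (∑-sublists-∷ f y xs) (∑-sublists-∷ (λ μ → f (x ∷ μ)) y xs))
  ∑-sublists-↭ inv (↭.trans p q) = trans (∑-sublists-↭ inv p) (∑-sublists-↭ inv q)

  ∑-sublists-++ : (f : List A → Carrier) → ∀ xs ys →
    ∑ R (sublists (xs ++ ys)) f ≈ ∑ R (sublists xs) λ α → ∑ R (sublists ys) λ β → f (α ++ β)
  ∑-sublists-++ f []       ys = sym (+-identityʳ _)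
  ∑-sublists-++ f (x ∷ xs) ys = begin
    ∑ R (sublists (x ∷ xs ++ ys)) f
      ≈⟨ ∑-sublists-∷ f x (xs ++ ys) ⟩
    ∑ R (sublists (xs ++ ys)) f + ∑ R (sublists (xs ++ ys)) (λ μ → f (x ∷ μ))
      ≈⟨ +-cong (∑-sublists-++ f xs ys) (∑-sublists-++ (λ μ → f (x ∷ μ)) xs ys) ⟩
    ∑ R (sublists xs) (λ α → ∑ R (sublists ys) λ β → f (α ++ β))
      + ∑ R (sublists xs) (λ α → ∑ R (sublists ys) λ β → f (x ∷ α ++ β))
      ≈⟨ ∑-sublists-∷ (λ α → ∑ R (sublists ys) λ β → f (α ++ β)) x xs ⟨
    ∑ R (sublists (x ∷ xs)) (λ α → ∑ R (sublists ys) λ β → f (α ++ β)) ∎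

  ∑-sublists-map : (h : I → A) (f : List A → Carrier) → ∀ xs →
    ∑ R (sublists (map h xs)) f ≈ ∑ R (sublists xs) (λ μ → f (map h μ))
  ∑-sublists-map h f []       = refl
  ∑-sublists-map h f (x ∷ xs) = begin
    ∑ R (sublists (map h (x ∷ xs))) f
      ≈⟨ ∑-sublists-∷ f (h x) (map h xs) ⟩
    ∑ R (sublists (map h xs)) f + ∑ R (sublists (map h xs)) (λ μ → f (h x ∷ μ))
      ≈⟨ +-cong (∑-sublists-map h f xs) (∑-sublists-map h (λ μ → f (h x ∷ μ)) xs) ⟩
    ∑ R (sublists xs) (λ μ → f (map h μ)) + ∑ R (sublists xs) (λ μ → f (map h (x ∷ μ)))
      ≈⟨ ∑-sublists-∷ (λ μ → f (map h μ)) x xs ⟨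
    ∑ R (sublists (x ∷ xs)) (λ μ → f (map h μ)) ∎

  ∑-sublists-filter : (P? : Decidable P) {f : List A → Carrier} →
    (∀ {μ} → Any P μ → f μ ≈ 0#) → ∀ xs →
    ∑ R (sublists xs) f ≈ ∑ R (sublists (filter (λ x → ¬? (P? x)) xs)) f
  ∑-sublists-filter P? f≈0 []       = refl
  ∑-sublists-filter P? {f} f≈0 (x ∷ xs) with P? x
  ... | yes px = begin
    ∑ R (sublists (x ∷ xs)) f
      ≈⟨ ∑-sublists-∷ f x xs ⟩
    ∑ R (sublists xs) f + ∑ R (sublists xs) (λ μ → f (x ∷ μ))
      ≈⟨ +-cong (∑-sublists-filter P? f≈0 xs) (∑-≈0 (λ μ → f≈0 (here px)) (sublists xs)) ⟩
    ∑ R (sublists (filter (λ x → ¬? (P? x)) xs)) f + 0#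
      ≈⟨ +-identityʳ _ ⟩
    ∑ R (sublists (filter (λ x → ¬? (P? x)) xs)) f ∎
  ... | no ¬px = begin
    ∑ R (sublists (x ∷ xs)) f
      ≈⟨ ∑-sublists-∷ f x xs ⟩
    ∑ R (sublists xs) f + ∑ R (sublists xs) (λ μ → f (x ∷ μ))
      ≈⟨ +-cong (∑-sublists-filter P? f≈0 xs) (∑-sublists-filter P? (f≈0 ∘ there) xs) ⟩
    _
      ≈⟨ ∑-sublists-∷ f x (filter (λ x → ¬? (P? x)) xs) ⟨
    ∑ R (sublists (x ∷ filter (λ x → ¬? (P? x)) xs)) f ∎

  -- Meant for the edges at one vertex, of which a perfect matching contains exactly one.
  ∑-sublists-singletons : {f : List A → Carrier} → f [] ≈ 0# → (∀ x y μ → f (x ∷ y ∷ μ) ≈ 0#) →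
    ∀ xs → ∑ R (sublists xs) f ≈ ∑ R xs (λ x → f (x ∷ []))
  ∑-sublists-singletons f[]≈0 f∷∷≈0 []       = trans (+-identityʳ _) f[]≈0
  ∑-sublists-singletons {f = f} f[]≈0 f∷∷≈0 (x ∷ xs) = begin
    ∑ R (sublists (x ∷ xs)) f
      ≈⟨ ∑-sublists-∷ f x xs ⟩
    ∑ R (sublists xs) f + ∑ R (sublists xs) (λ μ → f (x ∷ μ))
      ≈⟨ +-cong (∑-sublists-singletons f[]≈0 f∷∷≈0 xs) (empty (f∷∷≈0 x) xs) ⟩
    ∑ R xs (λ x → f (x ∷ [])) + f (x ∷ [])
      ≈⟨ +-comm _ _ ⟩
    ∑ R (x ∷ xs) (λ x → f (x ∷ [])) ∎
    where
    empty : {g : List _ → Carrier} → (∀ y μ → g (y ∷ μ) ≈ 0#) → ∀ xs → ∑ R (sublists xs) g ≈ g []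
    empty g∷≈0 []       = +-identityʳ _
    empty {g} g∷≈0 (x ∷ xs) = begin
      ∑ R (sublists (x ∷ xs)) g
        ≈⟨ ∑-sublists-∷ g x xs ⟩
      ∑ R (sublists xs) g + ∑ R (sublists xs) (λ μ → g (x ∷ μ))
        ≈⟨ +-cong (empty g∷≈0 xs) (∑-≈0 (g∷≈0 x) (sublists xs)) ⟩
      g [] + 0#
        ≈⟨ +-identityʳ _ ⟩
      g [] ∎

_≟ᵥ_ : (u v : Vertex n) → Dec (u ≡ v)
_≟ᵥ_ = Sum.≡-dec Fin._≟_ Fin._≟_

AllPairs-++⁻ : {_∼_ : A → A → Set} → ∀ xs → AllPairs _∼_ (xs ++ ys) →
  AllPairs _∼_ xs × AllPairs _∼_ ys × All (λ x → All (x ∼_) ys) xs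
AllPairs-++⁻ []       ys∼           = [] , ys∼ , []
AllPairs-++⁻ (x ∷ xs) (x∼ ∷ xs++ys∼) with xs∼ , ys∼ , xs∼ys ← AllPairs-++⁻ xs xs++ys∼ =
  All.++⁻ˡ xs x∼ ∷ xs∼ , ys∼ , All.++⁻ʳ xs x∼ ∷ xs∼ys

-- Signed sums over perfect matchings as Pfaffians

module Matchings {c ℓ} (R : CommutativeRing c ℓ) {n : ℕ} (wt : Edge n → CommutativeRing.Carrier R) where

  open CommutativeRing R hiding (zero)
  open Pfaffian R
  open Sums R
  open SublistSums R
  open import Algebra.Properties.Ring ring using (-1*x≈-x)
  open import Algebra.Properties.AbelianGroup +-abelianGroup
    using () renaming (⁻¹-involutive to -‿involutive)
  open import Algebra.Properties.Semiring.Exp semiring using (^-homo-*)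
  open import Algebra.Properties.CommutativeSemigroup *-commutativeSemigroup
    using (interchange)
  open import Relation.Binary.Reasoning.Setoid setoid

  sign-* : ∀ k l → sign R (k ℕ.+ l) ≈ sign R k * sign R l
  sign-* = ^-homo-* (- 1#)

  -1*-1≈1 : - 1# * - 1# ≈ 1#
  -1*-1≈1 = trans (-1*x≈-x _) (-‿involutive 1#)

  -- The sign that an edge end at `x` contributes to the degree of `u`. Its product over a
  -- duplicate-free list is -1 or 1 according to whether `x` belongs to the list.
  δ : Vertex n → Vertex n → Carrier
  δ x u = if does (u ≟ᵥ x) then - 1# else 1#

  ∏-δ-∉ : ∀ {x us} → All (_≢ x) us → ∏ R us (δ x) ≈ 1#
  ∏-δ-∉ {x} = ∏-≈1 ∘ All.map δ≈1
    where
    δ≈1 : ∀ {u} → u ≢ x → δ x u ≈ 1#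
    δ≈1 {u} u≢x with u ≟ᵥ x
    ... | yes u≡x = contradiction u≡x u≢x
    ... | no  _   = refl

  ∏-δ-∈ : ∀ {x us} → Unique us → x ∈ us → ∏ R us (δ x) ≈ - 1#
  ∏-δ-∈ {x} (x≢us ∷ us!) (here ≡.refl) with x ≟ᵥ x
  ... | yes _  = trans (*-congˡ (∏-δ-∉ (All.map ≡.≢-sym x≢us))) (*-identityʳ _)
  ... | no x≢x = contradiction ≡.refl x≢x
  ∏-δ-∈ {x} {u ∷ us} (u≢us ∷ us!) (there x∈us) with u ≟ᵥ x
  ... | yes u≡x = contradiction u≡x (All.lookup u≢us x∈us)
  ... | no  _   = trans (*-identityˡ _) (∏-δ-∈ us! x∈us)

  -- The ends must differ because `degree` counts edges and not ends: at a loop the degree is 1, but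
  -- the product of the two signs is 1 as well.
  sign-degree-edge : ∀ {x y} → x ≢ y → ∀ u → sign R (degree u (edge x y ∷ [])) ≈ δ x u * δ y u
  sign-degree-edge {x} {y} x≢y u with u ≟ᵥ x | u ≟ᵥ y
  ... | yes u≡x | yes u≡y = contradiction (≡.trans (≡.sym u≡x) u≡y) x≢y
  ... | yes u≡x | no  _   = reflexive (≡.cong (sign R) (degree-∈ {v = u} [] (∈ₑ-edge⁺ x y (inj₁ u≡x))))
  ... | no  _   | yes u≡y = trans (reflexive (≡.cong (sign R) (degree-∈ {v = u} [] (∈ₑ-edge⁺ x y (inj₂ u≡y))))) (*-comm _ _)
  ... | no  u≢x | no  u≢y = trans (reflexive (≡.cong (sign R) (degree-∉ {v = u} [] (∉ₑ-edge u≢x u≢y)))) (sym (*-identityˡ _))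

  -- Extended by 0 to all sets of edges, so that sums run over all sublists and can be split and
  -- reordered without regard to the matching condition.
  term : List (Vertex n) → List (Edge n) → Carrier
  term vs μ = if does (covers? vs μ) then sign R (χ μ) * ∏ R μ wt else 0#

  term-covered : ∀ vs μ → Covers vs μ → term vs μ ≈ sign R (χ μ) * ∏ R μ wt
  term-covered vs μ covered with covers? vs μ
  ... | yes _        = refl
  ... | no uncovered = contradiction covered uncovered

  term-uncovered : ∀ vs μ → ¬ Covers vs μ → term vs μ ≈ 0#
  term-uncovered vs μ uncovered with covers? vs μ
  ... | yes covered = contradiction covered uncovered
  ... | no _        = refl

  term-↭ : ∀ vs {μ ν} → μ ↭ ν → term vs μ ≈ term vs ν
  term-↭ vs {μ} {ν} p with covers? vs μ
  ... | yes covered = trans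
    (*-cong (reflexive (≡.cong (sign R) (χ-↭ p))) (∏-↭ p))
    (sym (term-covered vs ν (All.map (λ {v} → ≡.trans (≡.sym (degree-↭ v p))) covered)))
  ... | no uncovered = sym (term-uncovered vs ν (uncovered ∘ All.map (λ {v} → ≡.trans (degree-↭ v p))))

  matchingSum : List (Vertex n) → Carrier
  matchingSum vs = ∑ R (sublists (pairEdges vs)) (term vs)

  -- The matchings in which the first vertex `v` has partner `w`: the vertices of `as` lie between
  -- the two along the boundary, those of `bs` beyond `w`.
  module Split {v w : Vertex n} {as bs : List (Vertex n)} (sorted : AllPairs _≺_ (v ∷ as ++ w ∷ bs)) where

    e : Edge n
    e = edge v w

    v≺as : All (v ≺_) as
    v≺as = All.++⁻ˡ as (AllPairs.head sorted)

    v≺w∷bs : All (v ≺_) (w ∷ bs)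
    v≺w∷bs = All.++⁻ʳ as (AllPairs.head sorted)

    as-sorted : AllPairs _≺_ as
    as-sorted = proj₁ (AllPairs-++⁻ as (AllPairs.tail sorted))

    w∷bs-sorted : AllPairs _≺_ (w ∷ bs)
    w∷bs-sorted = proj₁ (proj₂ (AllPairs-++⁻ as (AllPairs.tail sorted)))

    as≺w∷bs : All (λ a → All (a ≺_) (w ∷ bs)) as
    as≺w∷bs = proj₂ (proj₂ (AllPairs-++⁻ as (AllPairs.tail sorted)))

    others : All (λ u → u ≢ v × u ≢ w) (as ++ bs)
    others = All.++⁺
      (All.zipWith (λ (v≺a , a≺) → ≡.≢-sym (≺⇒≢ v≺a) , ≺⇒≢ (All.head a≺)) (v≺as , as≺w∷bs))
      (All.zipWith (λ (v≺b , w≺b) → ≡.≢-sym (≺⇒≢ v≺b) , ≡.≢-sym (≺⇒≢ w≺b))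
        (All.tail v≺w∷bs , AllPairs.head w∷bs-sorted))

    -- An edge of the remaining vertices crosses e exactly when it has one
    -- rather than zero or two ends in as.
    Compatible : Edge n → Set ℓ
    Compatible f = sign R (length (filter (crosses? e) (f ∷ []))) ≈
                   ∏ R as (λ u → sign R (degree u (f ∷ [])))

    Remaining : Edge n → Set ℓ
    Remaining f = (¬ v ∈ₑ f) × (¬ w ∈ₑ f) × Compatible f

    as-unique : Unique as
    as-unique = AllPairs.map ≺⇒≢ as-sorted

    InA InB : Vertex n → Set
    InA x = v ≺ x × x ≺ w × x ∈ as
    InB x = v ≺ x × w ≺ x × All (_≢ x) as

    all-InA : All InA as
    all-InA = All.tabulate λ x∈as → All.lookup v≺as x∈as , All.head (All.lookup as≺w∷bs x∈as) , x∈as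

    all-InB : All InB bs
    all-InB = All.tabulate λ x∈bs → All.lookup v≺w∷bs (there x∈bs) , All.lookup (AllPairs.head w∷bs-sorted) x∈bs ,
      All.map (λ a≺ → ≺⇒≢ (All.lookup a≺ (there x∈bs))) as≺w∷bs

    ∏-degree-edge : ∀ {x y} → x ≢ y →
      ∏ R as (λ u → sign R (degree u (edge x y ∷ []))) ≈ ∏ R as (δ x) * ∏ R as (δ y)
    ∏-degree-edge x≢y = trans (∏-cong (sign-degree-edge x≢y) as) (∏-* _ _ as)

    crossing : ∀ {f} → Crosses e f → sign R (length (filter (crosses? e) (f ∷ []))) ≈ - 1#
    crossing c = trans (reflexive (≡.cong (λ fs → sign R (length fs)) (List.filter-accept (crosses? e) c))) (*-identityʳ _)

    noncrossing : ∀ {f} → ¬ Crosses e f → sign R (length (filter (crosses? e) (f ∷ []))) ≈ 1#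
    noncrossing ¬c = reflexive (≡.cong (λ fs → sign R (length fs)) (List.filter-reject (crosses? e) ¬c))

    compatible-aa : ∀ {x y} → InA x → InA y → x ≺ y → Compatible (edge x y)
    compatible-aa (v≺x , _ , x∈as) (_ , y≺w , y∈as) x≺y = trans
      (noncrossing (¬crosses-nested v≺x x≺y y≺w))
      (sym (trans (∏-degree-edge (≺⇒≢ x≺y))
        (trans (*-cong (∏-δ-∈ as-unique x∈as) (∏-δ-∈ as-unique y∈as)) -1*-1≈1)))

    compatible-ab : ∀ {x y} → InA x → InB y → Compatible (edge x y)
    compatible-ab (v≺x , x≺w , x∈as) (_ , w≺y , y∉as) = trans
      (crossing (crosses-interleaved v≺x x≺w w≺y))
      (sym (trans (∏-degree-edge (≺⇒≢ (≺-trans x≺w w≺y)))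
        (trans (*-cong (∏-δ-∈ as-unique x∈as) (∏-δ-∉ y∉as)) (*-identityʳ _))))

    compatible-bb : ∀ {x y} → InB x → InB y → x ≺ y → Compatible (edge x y)
    compatible-bb (v≺x , w≺x , x∉as) (_ , w≺y , y∉as) x≺y = trans
      (noncrossing (¬crosses-disjoint (All.head v≺w∷bs) w≺x x≺y))
      (sym (trans (∏-degree-edge (≺⇒≢ x≺y))
        (trans (*-cong (∏-δ-∉ x∉as) (∏-δ-∉ y∉as)) (*-identityˡ _))))

    distinct-a : ∀ {x} → InA x → v ≢ x × w ≢ x
    distinct-a (v≺x , x≺w , _) = ≺⇒≢ v≺x , ≡.≢-sym (≺⇒≢ x≺w)

    distinct-b : ∀ {x} → InB x → v ≢ x × w ≢ x
    distinct-b (v≺x , w≺x , _) = ≺⇒≢ v≺x , ≺⇒≢ w≺x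

    remain : ∀ {x y} → v ≢ x × w ≢ x → v ≢ y × w ≢ y → Compatible (edge x y) → Remaining (edge x y)
    remain (v≢x , w≢x) (v≢y , w≢y) compatible = ∉ₑ-edge v≢x v≢y , ∉ₑ-edge w≢x w≢y , compatible

    remaining : All Remaining (pairEdges (as ++ bs))
    remaining = All-pairEdges (AllPairs.++⁺
      (AllPairs-map-All (λ x y x≺y → remain (distinct-a x) (distinct-a y) (compatible-aa x y x≺y)) all-InA as-sorted)
      (AllPairs-map-All (λ x y x≺y → remain (distinct-b x) (distinct-b y) (compatible-bb x y x≺y)) all-InB
        (AllPairs.tail w∷bs-sorted))
      (All.map (λ x → All.map (λ y → remain (distinct-a x) (distinct-b y) (compatible-ab x y)) all-InB) all-InA))

    -- Both sides are multiplicative in `μ`, so `Compatible` settles the claim edge by edge. This is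
    -- a degree count modulo 2: an edge with both ends in `as` contributes to two degrees and
    -- cancels.
    crossings : ∀ {μ} → All Remaining μ →
      sign R (length (filter (crosses? e) μ)) ≈ ∏ R as (λ u → sign R (degree u μ))
    crossings []                               = sym (∏-≈1 (All.universal (λ _ → refl) as))
    crossings (_∷_ {f} {μ} (_ , _ , compat) rest) = begin
      sign R (# (f ∷ μ))
        ≡⟨ ≡.cong (sign R) (count-++ (crosses? e) (f ∷ []) μ) ⟩
      sign R (# (f ∷ []) ℕ.+ # μ)
        ≈⟨ sign-* (# (f ∷ [])) (# μ) ⟩
      sign R (# (f ∷ [])) * sign R (# μ)
        ≈⟨ *-cong compat (crossings rest) ⟩
      ∏ R as (λ u → sign R (degree u (f ∷ []))) * ∏ R as (λ u → sign R (degree u μ))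
        ≈⟨ ∏-* _ _ as ⟨
      ∏ R as (λ u → sign R (degree u (f ∷ [])) * sign R (degree u μ))
        ≈⟨ ∏-cong (λ u → sign-* (degree u (f ∷ [])) (degree u μ)) as ⟨
      ∏ R as (λ u → sign R (degree u (f ∷ []) ℕ.+ degree u μ))
        ≈⟨ ∏-cong (λ u → reflexive (≡.cong (sign R) (≡.sym (count-++ (u ∈ₑ?_) (f ∷ []) μ)))) as ⟩
      ∏ R as (λ u → sign R (degree u (f ∷ μ))) ∎
      where
      # : List (Edge n) → ℕ
      # μ = length (filter (crosses? e) μ)

    -- Every degree in `as` is 1, so each vertex between `v` and `w` contributes one factor -1.
    crossings-covered : ∀ {μ} → All Remaining μ → Covers as μ →
      sign R (length (filter (crosses? e) μ)) ≈ sgn as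
    crossings-covered {μ} remaining covered = trans (crossings remaining) (odd covered)
      where
      odd : ∀ {as} → Covers as μ → ∏ R as (λ u → sign R (degree u μ)) ≈ sgn as
      odd []           = refl
      odd (eq ∷ covered) = *-cong (trans (reflexive (≡.cong (sign R) eq)) (*-identityʳ _)) (odd covered)

    covers⁺ : ∀ {μ} → All Remaining μ → Covers (as ++ bs) μ → Covers (v ∷ as ++ w ∷ bs) (e ∷ μ)
    covers⁺ {μ} rest covered =
      (≡.trans (degree-∈ μ (∈ₑ-edge⁺ v w (inj₁ ≡.refl))) (≡.cong suc (degree-none (All.map proj₁ rest)))) ∷
      All.++⁺ (All.++⁻ˡ as covered′)
        ((≡.trans (degree-∈ μ (∈ₑ-edge⁺ v w (inj₂ ≡.refl))) (≡.cong suc (degree-none (All.map (proj₁ ∘ proj₂) rest)))) ∷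
         All.++⁻ʳ as covered′)
      where
      covered′ : Covers (as ++ bs) (e ∷ μ)
      covered′ = All.zipWith (λ ((u≢v , u≢w) , eq) → ≡.trans (degree-∉ μ (∉ₑ-edge u≢v u≢w)) eq) (others , covered)

    covers⁻ : ∀ {μ} → Covers (v ∷ as ++ w ∷ bs) (e ∷ μ) → Covers (as ++ bs) μ
    covers⁻ {μ} (_ ∷ covered) = All.zipWith
      (λ ((u≢v , u≢w) , eq) → ≡.trans (≡.sym (degree-∉ μ (∉ₑ-edge u≢v u≢w))) eq)
      (others , All.++⁺ (All.++⁻ˡ as covered) (All.tail (All.++⁻ʳ as covered)))

    term-step : ∀ {μ} → All Remaining μ →
      term (v ∷ as ++ w ∷ bs) (e ∷ μ) ≈ sgn as * wt e * term (as ++ bs) μ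
    term-step {μ} rest with covers? (as ++ bs) μ
    ... | no uncovered = trans (term-uncovered (v ∷ as ++ w ∷ bs) (e ∷ μ) (uncovered ∘ covers⁻)) (sym (zeroʳ _))
    ... | yes covered  = begin
      term (v ∷ as ++ w ∷ bs) (e ∷ μ)
        ≈⟨ term-covered (v ∷ as ++ w ∷ bs) (e ∷ μ) (covers⁺ rest covered) ⟩
      sign R (length (filter (crosses? e) μ) ℕ.+ χ μ) * (wt e * ∏ R μ wt)
        ≈⟨ *-congʳ (sign-* (length (filter (crosses? e) μ)) (χ μ)) ⟩
      sign R (length (filter (crosses? e) μ)) * sign R (χ μ) * (wt e * ∏ R μ wt)
        ≈⟨ *-congʳ (*-congʳ (crossings-covered rest (All.++⁻ˡ as covered))) ⟩
      sgn as * sign R (χ μ) * (wt e * ∏ R μ wt)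
        ≈⟨ interchange _ _ _ _ ⟩
      sgn as * wt e * (sign R (χ μ) * ∏ R μ wt) ∎

    -- As `e` already covers `w`, any further edge at `w` makes the term 0. Dropping those edges
    -- leaves the complete graph on `as ++ bs`.
    fibre : ∑ R (sublists (pairEdges (as ++ w ∷ bs))) (λ μ → term (v ∷ as ++ w ∷ bs) (e ∷ μ)) ≈
            sgn as * (wt e * matchingSum (as ++ bs))
    fibre = begin
      ∑ R (sublists (pairEdges (as ++ w ∷ bs))) f
        ≈⟨ ∑-sublists-filter (w ∈ₑ?_) (λ {μ} w∈μ → term-uncovered (v ∷ as ++ w ∷ bs) (e ∷ μ) (λ covered → degree-some w∈μ
             (ℕ.suc-injective (≡.trans (≡.sym (degree-∈ _ (∈ₑ-edge⁺ v w (inj₂ ≡.refl))))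
               (All.head (All.++⁻ʳ as (All.tail covered))))))) (pairEdges (as ++ w ∷ bs)) ⟩
      ∑ R (sublists (filter (λ e → ¬? (w ∈ₑ? e)) (pairEdges (as ++ w ∷ bs)))) f
        ≡⟨ ≡.cong (λ es → ∑ R (sublists es) f) (filter-∌-pairEdges as w bs (All.map (≡.≢-sym ∘ proj₂) others)) ⟩
      ∑ R (sublists (pairEdges (as ++ bs))) f
        ≈⟨ ∑-sublists-cong remaining term-step ⟩
      ∑ R (sublists (pairEdges (as ++ bs))) (λ μ → sgn as * wt e * term (as ++ bs) μ)
        ≈⟨ ∑-*ˡ _ _ (sublists (pairEdges (as ++ bs))) ⟩
      sgn as * wt e * matchingSum (as ++ bs)
        ≈⟨ *-assoc _ _ _ ⟩
      sgn as * (wt e * matchingSum (as ++ bs)) ∎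
      where
      f : List (Edge n) → Carrier
      f μ = term (v ∷ as ++ w ∷ bs) (e ∷ μ)

  -- A nonzero term has exactly one edge at `v`: `isolated` excludes none, `doubled` excludes two or
  -- more.
  star-sum : ∀ {v vs} → AllPairs _≺_ (v ∷ vs) → matchingSum (v ∷ vs) ≈
    ∑ R vs (λ w → ∑ R (sublists (pairEdges vs)) (λ μ → term (v ∷ vs) (edge v w ∷ μ)))
  star-sum {v} {vs} (v≺vs ∷ vs-sorted) = begin
    matchingSum (v ∷ vs)
      ≡⟨ ≡.cong (λ es → ∑ R (sublists es) (term (v ∷ vs))) (pairEdges-∷ v vs) ⟩
    ∑ R (sublists (map (edge v) vs ++ pairEdges vs)) (term (v ∷ vs))
      ≈⟨ ∑-sublists-++ (term (v ∷ vs)) (map (edge v) vs) (pairEdges vs) ⟩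
    ∑ R (sublists (map (edge v) vs)) (λ α → ∑ R (sublists (pairEdges vs)) (λ μ → term (v ∷ vs) (α ++ μ)))
      ≈⟨ ∑-sublists-map (edge v) _ vs ⟩
    ∑ R (sublists vs) (λ ws → ∑ R (sublists (pairEdges vs)) (λ μ → term (v ∷ vs) (map (edge v) ws ++ μ)))
      ≈⟨ ∑-sublists-singletons isolated (λ x y ws → ∑-≈0 (λ μ → doubled x y (map (edge v) ws ++ μ)) (sublists (pairEdges vs))) vs ⟩
    ∑ R vs (λ w → ∑ R (sublists (pairEdges vs)) (λ μ → term (v ∷ vs) (edge v w ∷ μ))) ∎
    where
    v∈ₑ : ∀ w → v ∈ₑ edge v w
    v∈ₑ w = ∈ₑ-edge⁺ v w (inj₁ ≡.refl)
    isolated : ∑ R (sublists (pairEdges vs)) (term (v ∷ vs)) ≈ 0#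
    isolated = trans
      (∑-sublists-cong {P = λ f → ¬ v ∈ₑ f}
        (All-pairEdges (AllPairs-map-All (λ v≺x v≺y _ → ∉ₑ-edge (≺⇒≢ v≺x) (≺⇒≢ v≺y)) v≺vs vs-sorted))
        (λ {μ} v∉μ → term-uncovered (v ∷ vs) μ (λ covered → ℕ.0≢1+n (≡.trans (≡.sym (degree-none v∉μ)) (All.head covered)))))
      (∑-≈0 (λ _ → refl) (sublists (pairEdges vs)))
    doubled : ∀ x y μ → term (v ∷ vs) (edge v x ∷ edge v y ∷ μ) ≈ 0#
    doubled x y μ = term-uncovered (v ∷ vs) (edge v x ∷ edge v y ∷ μ) λ covered → ℕ.0≢1+n (ℕ.suc-injective
      (≡.trans (≡.sym (All.head covered)) (≡.trans (degree-∈ _ (v∈ₑ x)) (≡.cong suc (degree-∈ μ (v∈ₑ y))))))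

  ∑≈expand : {h : A → Carrier} {g : A → List A → Carrier} → ∀ xs →
    (∀ as x bs → xs ≡ as ++ x ∷ bs → h x ≈ sgn as * g x (as ++ bs)) →
    ∑ R xs h ≈ expand g xs
  ∑≈expand []       eq = refl
  ∑≈expand {h = h} {g} (x ∷ xs) eq = +-cong (trans (eq [] x xs ≡.refl) (*-identityˡ _)) (begin
    ∑ R xs h
      -- Inserting (-1)(-1) brings out the minus sign of the tail of `expand`; the factor left
      -- inside accounts for the sign of `x` in the hypothesis.
      ≈⟨ ∑-cong (λ y → trans (sym (*-identityˡ _)) (trans (*-congʳ (sym -1*-1≈1)) (*-assoc _ _ _))) xs ⟩
    ∑ R xs (λ y → - 1# * (- 1# * h y))
      ≈⟨ ∑-*ˡ _ _ xs ⟩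
    - 1# * ∑ R xs (λ y → - 1# * h y)
      ≈⟨ -1*x≈-x _ ⟩
    - ∑ R xs (λ y → - 1# * h y)
      ≈⟨ -‿cong (∑≈expand xs (λ as y bs xs≡ → trans (*-congˡ (eq (x ∷ as) y bs (≡.cong (x ∷_) xs≡)))
           (trans (sym (*-assoc _ _ _)) (*-congʳ (trans (sym (*-assoc _ _ _)) (trans (*-congʳ -1*-1≈1) (*-identityˡ _))))))) ⟩
    - expand (λ y ys → g y (x ∷ ys)) xs ∎)

  -- Deleting `v` and its partner leaves a sorted list with one pair fewer, and the sign of `fibre`
  -- is the one that `expand` gives to the partner, so both sides obey the same recursion.
  matchingSum≈pf : {ω : Vertex n → Vertex n → Carrier} → (∀ {u v} → u ≺ v → wt (edge u v) ≈ ω u v) →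
    ∀ m vs → AllPairs _≺_ vs → length vs ≡ m ℕ.+ m → matchingSum vs ≈ pf ω m vs
  matchingSum≈pf wt≈ω zero    []       _      _  = trans (+-identityʳ _) (*-identityˡ _)
  matchingSum≈pf {ω} wt≈ω (suc m) (v ∷ vs) sorted eq = trans (star-sum sorted) (∑≈expand vs split)
    where
    split : ∀ as w bs → vs ≡ as ++ w ∷ bs →
      ∑ R (sublists (pairEdges vs)) (λ μ → term (v ∷ vs) (edge v w ∷ μ)) ≈
      sgn as * (ω v w * pf ω m (as ++ bs))
    split as w bs ≡.refl = trans (Split.fibre sorted)
      (*-congˡ (*-cong (wt≈ω (All.head (All.++⁻ʳ as (AllPairs.head sorted))))
        (matchingSum≈pf wt≈ω m (as ++ bs) as++bs-sorted len)))
      where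
      as++bs-sorted : AllPairs _≺_ (as ++ bs)
      as++bs-sorted with as-sorted , (_ ∷ bs-sorted) , as≺ ← AllPairs-++⁻ as (AllPairs.tail sorted) =
        AllPairs.++⁺ as-sorted bs-sorted (All.map All.tail as≺)
      len : length (as ++ bs) ≡ m ℕ.+ m
      len = ℕ.suc-injective (ℕ.suc-injective (≡.trans (≡.cong suc (≡.sym (List.length-++-sucʳ as w bs)))
        (≡.trans eq (ℕ.+-suc (suc m) m))))

-- Brauer diagrams

tabulate-∷ʳ : ∀ (f : Fin (suc n) → A) → tabulate f ≡ tabulate (f ∘ inject₁) ∷ʳ f (fromℕ n)
tabulate-∷ʳ {zero}  f = ≡.refl
tabulate-∷ʳ {suc n} f = ≡.cong (f zero ∷_) (tabulate-∷ʳ (f ∘ suc))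

reverse-tabulate : ∀ (f : Fin n → A) → reverse (tabulate f) ≡ tabulate (f ∘ opposite)
reverse-tabulate {zero}  f = ≡.refl
reverse-tabulate {suc n} f = begin
  reverse (tabulate f)                              ≡⟨ ≡.cong reverse (tabulate-∷ʳ f) ⟩
  reverse (tabulate (f ∘ inject₁) ∷ʳ f (fromℕ n))   ≡⟨ List.reverse-++ (tabulate (f ∘ inject₁)) (f (fromℕ n) ∷ []) ⟩
  f (fromℕ n) ∷ reverse (tabulate (f ∘ inject₁))    ≡⟨ ≡.cong (f (fromℕ n) ∷_) (reverse-tabulate (f ∘ inject₁)) ⟩
  tabulate (f ∘ opposite)                           ∎
  where open ≡.≡-Reasoning

opposite-mono-< : {i j : Fin n} → i < j → opposite j < opposite i
opposite-mono-< {i = i} {j} i<j = ≡.subst₂ ℕ._<_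
  (≡.sym (Fin.opposite-prop j)) (≡.sym (Fin.opposite-prop i)) (ℕ.∸-monoʳ-< (s≤s i<j) (Fin.toℕ<n j))

-- The positions from right to left: increasing labels for `B`, decreasing labels for `F`.
bottoms : ∀ n → List (Vertex n)
bottoms n = map (bottom ∘ opposite) (allFin n)

boundary : ∀ n → List (Vertex n)
boundary n = map top (allFin n) ++ bottoms n

boundary-sorted : ∀ n → AllPairs _≺_ (boundary n)
boundary-sorted n = AllPairs.++⁺
  (AllPairs.map⁺ (AllPairs.tabulate⁺-< ₁∼₁))
  (AllPairs.map⁺ (AllPairs.tabulate⁺-< (₂∼₂ ∘ opposite-mono-<)))
  (All.map⁺ (All.universal (λ _ → All.map⁺ (All.universal (λ _ → ₁∼₂) (allFin n))) (allFin n)))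

bottom∈bottoms : (i : Fin n) → bottom i ∈ bottoms n
bottom∈bottoms {n} i = ≡.subst (λ j → bottom j ∈ bottoms n)
  (Fin.opposite-involutive i) (∈-map⁺ (bottom ∘ opposite) (∈-allFin (opposite i)))

∈-boundary : (v : Vertex n) → v ∈ boundary n
∈-boundary     (top i)    = ∈-++⁺ˡ (∈-map⁺ top (∈-allFin i))
∈-boundary {n} (bottom i) = ∈-++⁺ʳ (map top (allFin n)) (bottom∈bottoms i)

length-allFin : ∀ n → length (allFin n) ≡ n
length-allFin n = List.length-tabulate {n = n} id

length-boundary : ∀ n → length (boundary n) ≡ n ℕ.+ n
length-boundary n = ≡.trans (List.length-++ (map top (allFin n))) (≡.cong₂ ℕ._+_
  (≡.trans (List.length-map top (allFin n)) (length-allFin n))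
  (≡.trans (List.length-map (bottom ∘ opposite) (allFin n)) (length-allFin n)))

∈-orderedPairs : {vs : List (Vertex n)} {u w : Vertex n} → AllPairs _≺_ vs →
  u ∈ vs → w ∈ vs → u ≺ w → (u , w) ∈ orderedPairs vs
∈-orderedPairs (v≺vs ∷ vs≺) (here ≡.refl) (here ≡.refl) u≺w = contradiction ≡.refl (≺⇒≢ u≺w)
∈-orderedPairs (v≺vs ∷ vs≺) (here ≡.refl) (there w∈)    u≺w = ∈-++⁺ˡ (∈-map⁺ _ w∈)
∈-orderedPairs (v≺vs ∷ vs≺) (there u∈)    (here ≡.refl) u≺w = contradiction (All.lookup v≺vs u∈) (≺-asym u≺w)
∈-orderedPairs {vs = v ∷ vs} (v≺vs ∷ vs≺) (there u∈) (there w∈) u≺w =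
  ∈-++⁺ʳ (map (v ,_) vs) (∈-orderedPairs vs≺ u∈ w∈ u≺w)

pairEdges-unique : {vs : List (Vertex n)} → AllPairs _≺_ vs → Unique (pairEdges vs)
pairEdges-unique []                               = []
pairEdges-unique (_∷_ {v} {vs} v≺vs vs≺) = ≡.subst Unique (≡.sym (pairEdges-∷ v vs))
  (Unique.++⁺ (Unique.map⁺ (edge-injectiveʳ v) (AllPairs.map ≺⇒≢ vs≺)) (pairEdges-unique vs≺) disjoint)
  where
  v∉ : All (λ e → ¬ v ∈ₑ e) (pairEdges vs)
  v∉ = All-pairEdges (AllPairs-map-All (λ v≺x v≺y _ → ∉ₑ-edge (≺⇒≢ v≺x) (≺⇒≢ v≺y)) v≺vs vs≺)
  disjoint : ∀ {e} → ¬ (e ∈ map (edge v) vs × e ∈ pairEdges vs)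
  disjoint (e∈star , e∈rest) with w , _ , ≡.refl ← ∈-map⁻ (edge v) e∈star =
    All.lookup v∉ e∈rest (∈ₑ-edge⁺ v w (inj₁ ≡.refl))

∈-increasingPairs : {i j : Fin n} → i < j → (i , j) ∈ increasingPairs n
∈-increasingPairs i<j = ∈-filter⁺ increasing? (∈-cartesianProduct⁺ (∈-allFin _) (∈-allFin _)) i<j

increasingPairs-unique : ∀ n → Unique (increasingPairs n)
increasingPairs-unique n =
  Unique.filter⁺ increasing? (Unique.cartesianProduct⁺ (Unique.allFin⁺ n) (Unique.allFin⁺ n))

edges-unique : ∀ n → Unique (edges n)
edges-unique n = Unique.++⁺ (Unique.map⁺ (λ { ≡.refl → ≡.refl }) (increasingPairs-unique n))
  (Unique.++⁺ (Unique.map⁺ (λ { ≡.refl → ≡.refl }) (increasingPairs-unique n))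
    (Unique.map⁺ (λ { ≡.refl → ≡.refl }) (Unique.cartesianProduct⁺ (Unique.allFin⁺ n) (Unique.allFin⁺ n)))
    caps-arcs)
  cups-others
  where
  caps arcs : List (Edge n)
  caps = map (uncurry cap) (increasingPairs n)
  arcs = map (uncurry arc) (pairs n)
  caps-arcs : ∀ {e} → ¬ (e ∈ caps × e ∈ arcs)
  caps-arcs (e∈caps , e∈arcs) with ∈-map⁻ (uncurry cap) e∈caps | ∈-map⁻ (uncurry arc) e∈arcs
  ... | _ , _ , ≡.refl | _ , _ , ()
  cups-others : ∀ {e} → ¬ (e ∈ map (uncurry cup) (increasingPairs n) × e ∈ caps ++ arcs)
  cups-others (e∈cups , e∈others) with ∈-map⁻ (uncurry cup) e∈cups | ∈-++⁻ caps e∈others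
  ... | _ , _ , ≡.refl | inj₁ e∈caps with ∈-map⁻ (uncurry cap) e∈caps
  ...   | _ , _ , ()
  cups-others (e∈cups , e∈others) | _ , _ , ≡.refl | inj₂ e∈arcs with ∈-map⁻ (uncurry arc) e∈arcs
  ...   | _ , _ , ()

edge∈edges : {u w : Vertex n} → u ≺ w → edge u w ∈ edges n
edge∈edges (₁∼₁ i<j) = ∈-++⁺ˡ (∈-map⁺ (uncurry cup) (∈-increasingPairs i<j))
edge∈edges {n} ₁∼₂   = ∈-++⁺ʳ (map (uncurry cup) (increasingPairs n)) (∈-++⁺ʳ (map (uncurry cap) (increasingPairs n))
  (∈-map⁺ (uncurry arc) (∈-cartesianProduct⁺ (∈-allFin _) (∈-allFin _))))
edge∈edges {n} (₂∼₂ j<i) = ∈-++⁺ʳ (map (uncurry cup) (increasingPairs n))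
  (∈-++⁺ˡ (∈-map⁺ (uncurry cap) (∈-increasingPairs j<i)))

edges⇒≺ : {e : Edge n} → e ∈ edges n → Σ (Vertex n × Vertex n) λ (u , w) → u ≺ w × e ≡ edge u w
edges⇒≺ {n} e∈ with ∈-++⁻ (map (uncurry cup) (increasingPairs n)) e∈
... | inj₁ e∈cups with (i , j) , ij∈ , ≡.refl ← ∈-map⁻ (uncurry cup) e∈cups =
  (top i , top j) , ₁∼₁ (proj₂ (∈-filter⁻ increasing? {xs = pairs n} ij∈)) , ≡.refl
... | inj₂ e∈others with ∈-++⁻ (map (uncurry cap) (increasingPairs n)) e∈others
...   | inj₁ e∈caps with (i , j) , ij∈ , ≡.refl ← ∈-map⁻ (uncurry cap) e∈caps =
  (bottom j , bottom i) , ₂∼₂ (proj₂ (∈-filter⁻ increasing? {xs = pairs n} ij∈)) , ≡.refl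
...   | inj₂ e∈arcs with (i , j) , _ , ≡.refl ← ∈-map⁻ (uncurry arc) e∈arcs =
  (top i , bottom j) , ₁∼₂ , ≡.refl

-- The same complete graph in two orders: `edges` groups by kind, `pairEdges` by the first end along
-- the boundary. It is enough that both lists are free of duplicates and have the same members.
edges-↭ : ∀ n → edges n ↭ pairEdges (boundary n)
edges-↭ n = unique⇒↭ (edges-unique n) (pairEdges-unique (boundary-sorted n)) to from
  where
  to : ∀ {e} → e ∈ edges n → e ∈ pairEdges (boundary n)
  to e∈ with (u , w) , u≺w , ≡.refl ← edges⇒≺ e∈ =
    ∈-map⁺ (uncurry edge) (∈-orderedPairs (boundary-sorted n) (∈-boundary u) (∈-boundary w) u≺w)
  from : ∀ {e} → e ∈ pairEdges (boundary n) → e ∈ edges n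
  from = All.lookup (All-pairEdges (AllPairs.map edge∈edges (boundary-sorted n)))

sorted-≤ : ∀ {c} {C : Set c} (x : Fin n → Fin n → C) {i j} → i Fin.≤ j → sorted x i j ≡ x i j
sorted-≤ x {i} {j} i≤j =
  ≡.cong (λ c → if c then x i j else x j i) (dec-true (i Fin.≤? j) i≤j)

sorted-> : ∀ {c} {C : Set c} (x : Fin n → Fin n → C) {i j} → j < i → sorted x i j ≡ x j i
sorted-> x {i} {j} j<i =
  ≡.cong (λ c → if c then x i j else x j i) (dec-false (i Fin.≤? j) (ℕ.<⇒≱ j<i))

bottomLabel-involutive : ∀ L (i : Fin n) → bottomLabel L (bottomLabel L i) ≡ i
bottomLabel-involutive F i = ≡.refl
bottomLabel-involutive B i = Fin.opposite-involutive i

-- The skew form of a labelling, and the two determinants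

module BrauerSum {c ℓ} (R : CommutativeRing c ℓ) where

  open CommutativeRing R hiding (zero)
  open Pfaffian R
  open Isotropic R
  open Determinant R
  open Sums R
  open SublistSums R
  open import Algebra.Properties.Ring ring using (-1*x≈-x; -‿distribʳ-*)
  open import Algebra.Properties.AbelianGroup +-abelianGroup
    using () renaming (ε⁻¹≈ε to -0≈0; ⁻¹-involutive to -‿involutive)
  open import Algebra.Solver.Ring.NaturalCoefficients.Default commutativeSemiring
    using (solve; _:=_; _:+_; _:*_)
  open import Relation.Binary.Reasoning.Setoid setoid

  ∑-filter : (P? : Decidable P) (f : A → Carrier) → ∀ xs →
    ∑ R (filter P? xs) f ≈ ∑ R xs (λ x → if does (P? x) then f x else 0#)
  ∑-filter P? f []       = refl
  ∑-filter P? f (x ∷ xs) with P? x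
  ... | yes _ = +-congˡ (∑-filter P? f xs)
  ... | no  _ = trans (∑-filter P? f xs) (sym (+-identityˡ _))

  brauerSum≈pf : {wt : Edge n → Carrier} {ω : Vertex n → Vertex n → Carrier} →
    (∀ {u v} → u ≺ v → wt (edge u v) ≈ ω u v) →
    ∑ R (brauerDiagrams n) (λ μ → sign R (χ μ) * ∏ R μ wt) ≈ pf ω n (boundary n)
  brauerSum≈pf {n} {wt} {ω} wt≈ω = begin
    ∑ R (brauerDiagrams n) (λ μ → sign R (χ μ) * ∏ R μ wt)
      ≈⟨ ∑-filter isPerfectMatching? _ (sublists (edges n)) ⟩
    ∑ R (sublists (edges n)) (λ μ → if does (isPerfectMatching? μ) then sign R (χ μ) * ∏ R μ wt else 0#)
      ≈⟨ ∑-cong (λ μ → reflexive (≡.cong (λ c → if c then sign R (χ μ) * ∏ R μ wt else 0#)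
           (does-⇔ (mk⇔ (to μ) (from μ)) (isPerfectMatching? μ) (covers? (boundary n) μ)))) (sublists (edges n)) ⟩
    ∑ R (sublists (edges n)) (term (boundary n))
      ≈⟨ ∑-sublists-↭ (term-↭ (boundary n)) (edges-↭ n) ⟩
    matchingSum (boundary n)
      ≈⟨ matchingSum≈pf wt≈ω n (boundary n) (boundary-sorted n) (length-boundary n) ⟩
    pf ω n (boundary n) ∎
    where
    open Matchings R wt
    to : ∀ μ → IsPerfectMatching μ → Covers (boundary n) μ
    to μ (tops , bottoms) = All.++⁺ (All.map⁺ (All.universal tops (allFin n)))
      (All.map⁺ (All.universal (bottoms ∘ opposite) (allFin n)))
    from : ∀ μ → Covers (boundary n) μ → IsPerfectMatching μ
    from μ covers = (λ i → All.lookup covers (∈-boundary (top i))) , (λ i → All.lookup covers (∈-boundary (bottom i)))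

  module Form {n : ℕ} (a b : Matrix R n) (L : Labelling) (κ k : Carrier) (k²κ≈-1 : k * (k * κ) ≈ - 1#) where

    S : Matrix R n
    S i j with Fin.<-cmp i j
    ... | tri< _ _ _ = b i j
    ... | tri≈ _ _ _ = 0#
    ... | tri> _ _ _ = - b j i

    S-< : ∀ {i j} → i < j → S i j ≡ b i j
    S-< {i} {j} i<j with Fin.<-cmp i j
    ... | tri< _ _ _    = ≡.refl
    ... | tri≈ i≮j _ _  = contradiction i<j i≮j
    ... | tri> i≮j _ _  = contradiction i<j i≮j

    S-> : ∀ {i j} → j < i → S i j ≡ - b j i
    S-> {i} {j} j<i with Fin.<-cmp i j
    ... | tri< _ _ j≮i = contradiction j<i j≮i
    ... | tri≈ _ _ j≮i = contradiction j<i j≮i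
    ... | tri> _ _ _   = ≡.refl

    S-diagonal : ∀ i → S i i ≡ 0#
    S-diagonal i with Fin.<-cmp i i
    ... | tri< _ i≢i _ = contradiction ≡.refl i≢i
    ... | tri≈ _ _ _   = ≡.refl
    ... | tri> _ i≢i _ = contradiction ≡.refl i≢i

    S-skew : ∀ i j → S i j ≈ - S j i
    S-skew i j with Fin.<-cmp i j
    ... | tri< i<j _ _    = trans (sym (-‿involutive _)) (-‿cong (reflexive (≡.sym (S-> i<j))))
    ... | tri≈ _ ≡.refl _ = trans (sym -0≈0) (-‿cong (reflexive (≡.sym (S-diagonal i))))
    ... | tri> _ _ j<i    = -‿cong (reflexive (≡.sym (S-< j<i)))

    sorted-sym : ∀ i j → sorted a i j ≡ sorted a j i
    sorted-sym i j with Fin.<-cmp i j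
    ... | tri< i<j _ _    = ≡.trans (sorted-≤ a (ℕ.<⇒≤ i<j)) (≡.sym (sorted-> a i<j))
    ... | tri≈ _ ≡.refl _ = ≡.refl
    ... | tri> _ _ j<i    = ≡.trans (sorted-> a j<i) (≡.sym (sorted-≤ a (ℕ.<⇒≤ j<i)))

    -- Vertices are positions, whereas the matrices are indexed by labels; `bottomLabel` translates
    -- between them.
    ω : Vertex n → Vertex n → Carrier
    ω (top i)    (top j)    = S i j
    ω (top i)    (bottom j) = sorted a i (bottomLabel L j)
    ω (bottom i) (top j)    = - sorted a j (bottomLabel L i)
    ω (bottom i) (bottom j) = κ * S (bottomLabel L i) (bottomLabel L j)

    ω-skew : ∀ u v → ω u v ≈ - ω v u
    ω-skew (top i)    (top j)    = S-skew i j
    ω-skew (top i)    (bottom j) = sym (-‿involutive _)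
    ω-skew (bottom i) (top j)    = refl
    ω-skew (bottom i) (bottom j) = trans (*-congˡ (S-skew (bottomLabel L i) (bottomLabel L j))) (sym (-‿distribʳ-* _ _))

    -- As bottomLabel L is an involution, this is the bottom vertex labelled i.
    β : Fin n → Vertex n
    β i = bottom (bottomLabel L i)

    β-isotropic : ∀ i → ω (β i) (β i) ≈ 0#
    β-isotropic i = trans (*-congˡ (reflexive (S-diagonal (bottomLabel L (bottomLabel L i))))) (zeroʳ κ)

    open Shear ω-skew top β β-isotropic k public

    ω-tβ : ∀ i j → ω (top i) (β j) ≡ sorted a i j
    ω-tβ i j = ≡.cong (sorted a i) (bottomLabel-involutive L j)

    ω-ββ : ∀ i j → ω (β i) (β j) ≡ κ * S i j
    ω-ββ i j = ≡.cong₂ (λ i j → κ * S i j) (bottomLabel-involutive L i) (bottomLabel-involutive L j)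

    -- The two contributions of `a` enter with opposite signs and cancel by the symmetry of
    -- `sorted a`; those of `S` add up to (1 + k²κ) S, which is 0 by the choice of `k`.
    sheared-isotropic : ∀ i j → ω̂ (inj₂ i) (inj₂ j) ≈ 0#
    sheared-isotropic i j = begin
      S i j + k * - sorted a j (bottomLabel L (bottomLabel L i)) + k * (ω (top i) (β j) + k * ω (β i) (β j))
        ≈⟨ +-cong (+-congˡ (*-congˡ (-‿cong (reflexive (≡.trans (ω-tβ j i) (sorted-sym j i))))))
             (*-congˡ (+-cong (reflexive (ω-tβ i j)) (*-congˡ (reflexive (ω-ββ i j))))) ⟩
      S i j + k * - aᵢⱼ + k * (aᵢⱼ + k * (κ * S i j))
        ≈⟨ solve 5 (λ s k a′ a κ → s :+ k :* a′ :+ k :* (a :+ k :* (κ :* s)) :=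
             k :* (a :+ a′) :+ (s :+ k :* (k :* κ) :* s)) refl _ _ _ _ _ ⟩
      k * (aᵢⱼ - aᵢⱼ) + (S i j + k * (k * κ) * S i j)
        ≈⟨ +-cong (trans (*-congˡ (-‿inverseʳ aᵢⱼ)) (zeroʳ k)) (+-congˡ (trans (*-congʳ k²κ≈-1) (-1*x≈-x _))) ⟩
      0# + (S i j - S i j)
        ≈⟨ trans (+-identityˡ _) (-‿inverseʳ _) ⟩
      0# ∎
      where aᵢⱼ = sorted a i j

    N : Fin n → Vertex n → Carrier
    N i v = ω (top i) v + k * ω (β i) v

    det≈dt-N : {M : Matrix R n} → (∀ i j → M i j ≈ sorted a i j + k * (κ * S i j)) →
      det R M ≈ dt N (allFin n) (map β (allFin n))
    det≈dt-N {M} M≈ = begin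
      det R M
        ≈⟨ det-cong (λ i j → trans (M≈ i j) (sym (+-cong (reflexive (ω-tβ i j)) (*-congˡ (reflexive (ω-ββ i j)))))) ⟩
      det R (λ i j → N i (β j))
        ≈⟨ det≈dt n N id β ⟩
      dt N (allFin n) (tabulate β)
        ≡⟨ ≡.cong (dt N (allFin n)) (List.map-tabulate id β) ⟨
      dt N (allFin n) (map β (allFin n)) ∎

    -- Cups and arcs agree with the form for either labelling; the caps are the place where `κ` has
    -- to fit the labelling.
    edgeWeight≈ω : (∀ {i j} → j < i → edgeWeight R a b L (cap j i) ≈ κ * S (bottomLabel L i) (bottomLabel L j)) →
      ∀ {u v} → u ≺ v → edgeWeight R a b L (edge u v) ≈ ω u v
    edgeWeight≈ω caps (₁∼₁ i<j) = reflexive (≡.sym (S-< i<j))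
    edgeWeight≈ω caps ₁∼₂       = refl
    edgeWeight≈ω caps (₂∼₂ j<i) = caps j<i

  -1*-1*x≈x : ∀ x → - 1# * (- 1# * x) ≈ x
  -1*-1*x≈x x = trans (-1*x≈-x _) (trans (-‿cong (-1*x≈-x x)) (-‿involutive x))

  det-M-F : (a b : Matrix R n) → det R (M-F R a b) ≈
    ∑ R (brauerDiagrams n) (λ μ → sign R (χ μ) * weight R a b F μ)
  det-M-F {n} a b = begin
    det R (M-F R a b)
      ≈⟨ det≈dt-N entry ⟩
    dt N (allFin n) (map bottom (allFin n))
      -- The boundary meets the bottom labels in decreasing order, so the version without a sign
      -- applies.
      ≈⟨ pf≈dt-reverse sheared-isotropic (allFin n)
           (λ i → ≡.subst (bottom i ∈_) reversed (bottom∈bottoms i)) (≡.sym (List.length-map bottom (allFin n))) ⟨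
    pf ω (length (allFin n)) (map top (allFin n) ++ reverse (map bottom (allFin n)))
      ≡⟨ ≡.cong₂ (λ m vs → pf ω m (map top (allFin n) ++ vs)) (length-allFin n) (≡.sym reversed) ⟩
    pf ω n (boundary n)
      ≈⟨ brauerSum≈pf (edgeWeight≈ω caps) ⟨
    ∑ R (brauerDiagrams n) (λ μ → sign R (χ μ) * weight R a b F μ) ∎
    where
    open Form a b F (- 1#) (- 1#) (-1*-1*x≈x (- 1#))
    reversed : bottoms n ≡ reverse (map bottom (allFin n))
    reversed = ≡.trans (List.map-tabulate id (bottom ∘ opposite))
      (≡.trans (≡.sym (reverse-tabulate bottom)) (≡.cong reverse (≡.sym (List.map-tabulate id bottom))))
    -- The right end `i` is read first, where `S` has the entry `- b j i`; the factor κ = -1 undoes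
    -- the sign.
    caps : ∀ {i j} → j < i → sorted b j i ≈ - 1# * S i j
    caps j<i = trans (reflexive (sorted-≤ b (ℕ.<⇒≤ j<i)))
      (sym (trans (-1*x≈-x _) (trans (-‿cong (reflexive (S-> j<i))) (-‿involutive _))))
    entry : ∀ i j → M-F R a b i j ≈ sorted a i j + - 1# * (- 1# * S i j)
    entry i j = trans entry′ (+-congˡ (sym (-1*-1*x≈x _)))
      where
      entry′ : M-F R a b i j ≈ sorted a i j + S i j
      entry′ with Fin.<-cmp i j
      ... | tri< i<j _ _    = +-congʳ (reflexive (≡.sym (sorted-≤ a (ℕ.<⇒≤ i<j))))
      ... | tri≈ _ ≡.refl _ = trans (sym (+-identityʳ _)) (+-congʳ (reflexive (≡.sym (sorted-≤ a (ℕ.≤-refl {toℕ i})))))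
      ... | tri> _ _ j<i    = +-congʳ (reflexive (≡.sym (sorted-> a j<i)))

  det-M-B : ∀ ι → ι * ι ≈ - 1# → (a b : Matrix R n) → det R (M-B R a b ι) ≈
    sign R (n C 2) * ∑ R (brauerDiagrams n) (λ μ → sign R (χ μ) * weight R a b B μ)
  det-M-B {n} ι ι²≈-1 a b = begin
    det R (M-B R a b ι)
      ≈⟨ det≈dt-N entry ⟩
    D
      -- The sign is its own inverse, so it can pass from the determinant to the Pfaffian.
      ≈⟨ trans (sym (*-assoc _ _ _)) (trans (*-congʳ (sign*sign≈1 (n C 2))) (*-identityˡ D)) ⟨
    sign R (n C 2) * (sign R (n C 2) * D)
      ≡⟨ ≡.cong (λ m → sign R (n C 2) * (sign R (m C 2) * D)) (length-allFin n) ⟨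
    sign R (n C 2) * (sign R (length (allFin n) C 2) * D)
      ≈⟨ *-congˡ (pf≈dt sheared-isotropic (allFin n) (λ i → bottom∈bottoms (opposite i))) ⟨
    sign R (n C 2) * pf ω (length (allFin n)) (boundary n)
      ≡⟨ ≡.cong (λ m → sign R (n C 2) * pf ω m (boundary n)) (length-allFin n) ⟩
    sign R (n C 2) * pf ω n (boundary n)
      ≈⟨ *-congˡ (brauerSum≈pf (edgeWeight≈ω caps)) ⟨
    sign R (n C 2) * ∑ R (brauerDiagrams n) (λ μ → sign R (χ μ) * weight R a b B μ) ∎
    where
    open Form a b B 1# ι (trans (*-congˡ (*-identityʳ ι)) ι²≈-1)
    D = dt N (allFin n) (map β (allFin n))
    -- Labels grow from right to left, so the end read first has the smaller label and no sign is to
    -- be corrected.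
    caps : ∀ {i j} → j < i → sorted b (opposite j) (opposite i) ≈ 1# * S (opposite i) (opposite j)
    caps j<i = trans (reflexive (≡.trans (sorted-> b (opposite-mono-< j<i)) (≡.sym (S-< (opposite-mono-< j<i)))))
      (sym (*-identityˡ _))
    entry : ∀ i j → M-B R a b ι i j ≈ sorted a i j + ι * (1# * S i j)
    entry i j = trans entry′ (+-congˡ (*-congˡ (sym (*-identityˡ _))))
      where
      entry′ : M-B R a b ι i j ≈ sorted a i j + ι * S i j
      entry′ with Fin.<-cmp i j
      ... | tri< i<j _ _    = +-congʳ (reflexive (≡.sym (sorted-≤ a (ℕ.<⇒≤ i<j))))
      ... | tri≈ _ ≡.refl _ = trans (sym (+-identityʳ _))
        (+-cong (reflexive (≡.sym (sorted-≤ a (ℕ.≤-refl {toℕ i})))) (sym (zeroʳ ι)))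
      ... | tri> _ _ j<i    = +-cong (reflexive (≡.sym (sorted-> a j<i))) (-‿distribʳ-* _ _)

theorem1 : ∀ {c ℓ} (R : CommutativeRing c ℓ) → let open CommutativeRing R in
    (ι : Carrier) → ι * ι ≈ - 1# →
    (n : ℕ) → n ≥ 1 → (a b : Matrix R n) →
    (det R (M-F R a b) ≈
    ∑ R (brauerDiagrams n) (λ μ → sign R (χ μ) * weight R a b F μ)) ×
    (det R (M-B R a b ι) ≈
    sign R (n C 2) * ∑ R (brauerDiagrams n) (λ μ → sign R (χ μ) * weight R a b B μ))
theorem1 R ι ι²≈-1 n _ a b = det-M-F a b , det-M-B ι ι²≈-1 a b
  where open BrauerSum R
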